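{- Let $P$ be a standard Young tableau. The Knuth class $K(P)$ is pattern-Knuth closed if and only if $P$ is a superstandard tableau of hook shape.
   Context: $\mathfrak{S}_n$ is the set of permutations of $[n]$ in one-line notation. For a permutation $\pi$, $P(\pi)$ denotes its Robinson–Schensted (row) insertion tableau. For a standard Young tableau $P$, the Knuth class is $K(P)=\{\pi\mid P(\pi)=P\}$. A permutation $\sigma$ contains $\pi$ as a pattern if some (not necessarily consecutive) subsequence of $\sigma$ is order-isomorphic to $\pi$; otherwise it avoids $\pi$. For a set $\Pi$ of permutations, $\mathfrak{S}_n(\Pi)$ is the set of $\sigma\in\mathfrak{S}_n$ avoiding every $\pi\in\Pi$. $\Pi$ is called pattern-Knuth closed if $\mathfrak{S}_n(\Pi)$ is a union of Knuth classes for all $n$. Young diagrams are drawn in English notation; a hook is a partition of the form $(a,1^b)$. The row superstandard tableau of shape $\lambda$ is the standard Young tableau whose first row is $1,2,\dots,\lambda_1$, whose second row is $\lambda_1+1,\dots,\lambda_1+\lambda_2$, and so on; the column superstandard tableau is defined similarly by filling the columns from left to right, each from top to bottom, with consecutive integers. A tableau is superstandard if it is row superstandard or column superstandard. -}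

module Defs where

open import Level using (0ℓ)
open import Data.Nat using (ℕ; suc; _+_; _<_; _>_; _<?_)
open import Data.Fin as Fin using (Fin; toℕ)
open import Data.Fin.Permutation using (Permutation′; _⟨$⟩ʳ_)
open import Data.List
  using (List; []; _∷_; [_]; length; map; concat; foldl; foldr; replicate; tabulate; applyUpTo; alignWith)
open import Data.List.Relation.Unary.All using (All)
open import Data.List.Relation.Unary.Linked using (Linked)
open import Data.List.Relation.Binary.Prefix.Heterogeneous using (Prefix)
open import Data.List.Relation.Binary.Permutation.Propositional using (_↭_)
open import Data.Maybe using (Maybe; just; nothing)
open import Data.Product using (_×_; _,_; ∃; ∃₂; map₁)
open import Data.Sum using (_⊎_)
open import Data.These as These using ()
open import Function using (id; flip; _⇔_)
open import Relation.Binary.PropositionalEquality using (_≡_; _≢_)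
open import Relation.Nullary using (¬_; yes; no)
open import Relation.Unary using (Pred; _∈_)

-- One-line notation, with values in 1, …, n rather than in Fin n.
word : ∀ {n} → Permutation′ n → List ℕ
word π = tabulate (λ i → suc (toℕ (π ⟨$⟩ʳ i)))

-- Rows from top to bottom (English notation).
Tableau : Set
Tableau = List (List ℕ)

-- x replaces the leftmost entry greater than x, which is returned;
-- if there is none, x is appended to the row.
bump : ℕ → List ℕ → List ℕ × Maybe ℕ
bump x [] = [ x ] , nothing
bump x (y ∷ ys) with x <? y
... | yes _ = x ∷ ys , just y
... | no  _ = map₁ (y ∷_) (bump x ys)

infixl 5 _←_

_←_ : Tableau → ℕ → Tableau
[]       ← x = [ [ x ] ]
(r ∷ rs) ← x with bump x r
... | r′ , nothing = r′ ∷ rs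
... | r′ , just y  = r′ ∷ (rs ← y)

insertionTableau : ∀ {n} → Permutation′ n → Tableau
insertionTableau π = foldl _←_ [] (word π)

record SYT : Set where
  field
    rows           : Tableau
    rowsNonempty   : All (_≢ []) rows
    rowsIncreasing : All (Linked _<_) rows
    -- Each row is at most as long as the row above it and exceeds it entrywise:
    -- the shape is a partition and the columns increase downwards.
    colsIncreasing : Linked (flip (Prefix _>_)) rows
    entries        : concat rows ↭ applyUpTo suc (length (concat rows))

open SYT public

shape : SYT → List ℕ
shape Q = map length (rows Q)

-- A set of permutations, possibly of different sizes.
PermSet : Set₁
PermSet = (n : ℕ) → Pred (Permutation′ n) 0ℓ

K : SYT → PermSet
K Q n π = insertionTableau π ≡ rows Q

-- σ contains π: the positions f 0 < f 1 < … carry a subsequence of σ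
-- order-isomorphic to π.
Contains : ∀ {m k} → Permutation′ m → Permutation′ k → Set
Contains {m} {k} σ π = ∃ λ (f : Fin k → Fin m) →
  (∀ {i j} → i Fin.< j → f i Fin.< f j) ×
  (∀ i j → (π ⟨$⟩ʳ i) Fin.< (π ⟨$⟩ʳ j) ⇔ (σ ⟨$⟩ʳ f i) Fin.< (σ ⟨$⟩ʳ f j))

𝔖 : (n : ℕ) → PermSet → Pred (Permutation′ n) 0ℓ
𝔖 n Π σ = ∀ {k} (π : Permutation′ k) → π ∈ Π k → ¬ Contains σ π

IsUnionOfKnuthClasses : ∀ {n} → Pred (Permutation′ n) 0ℓ → Set₁
IsUnionOfKnuthClasses {n} S =
  ∃ λ (𝒯 : Pred SYT 0ℓ) → ∀ σ → σ ∈ S ⇔ (∃ λ Q → Q ∈ 𝒯 × σ ∈ K Q n)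

PatternKnuthClosed : PermSet → Set₁
PatternKnuthClosed Π = ∀ n → IsUnionOfKnuthClasses (𝔖 n Π)

-- The empty partition is included as the degenerate hook (0).
IsHook : List ℕ → Set
IsHook λs = λs ≡ [] ⊎ ∃₂ λ a b → λs ≡ a ∷ replicate b 1

-- Lists of the prescribed lengths, filled in order with k + 1, k + 2, ….
fillFrom : ℕ → List ℕ → List (List ℕ)
fillFrom k []       = []
fillFrom k (a ∷ as) = applyUpTo (λ i → suc (k + i)) a ∷ fillFrom (k + a) as

-- Columns from left to right, each read from top to bottom.
columns : Tableau → List (List ℕ)
columns = foldr (alignWith (These.fold [_] id _∷_)) []

IsRowSuperstandard : SYT → Set
IsRowSuperstandard Q = rows Q ≡ fillFrom 0 (shape Q)

IsColumnSuperstandard : SYT → Set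
IsColumnSuperstandard Q = columns (rows Q) ≡ fillFrom 0 (map length (columns (rows Q)))

IsSuperstandard : SYT → Set
IsSuperstandard Q = IsRowSuperstandard Q ⊎ IsColumnSuperstandard Q

{-# OPTIONS --safe #-}

-- K(P) consists of the words Knuth equivalent to the row reading word of P, so K(P) is
-- pattern-Knuth closed iff the property "some subsequence is order-isomorphic to a word of K(P)"
-- is invariant under Knuth equivalence.
--
-- For a column superstandard hook the condition says that some letter is followed by an ascending
-- chain above it and a descending chain below it, of prescribed lengths, and this can be checked to
-- survive a Knuth move. Row superstandard hooks follow by reversing all words.
--
-- If P has p columns, ℓ rows and a cell (2,2), then one letter can be inserted into some word of
-- K(P) so that the longest ascending and the longest descending chains both grow. If R is the
-- insertion tableau of the result, then deleting one letter from the reading word of R leaves an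
-- ascending chain of length > p or a descending one of length > ℓ, so the reading word of R
-- avoids K(P).
--
-- If P is a hook but not superstandard, then, up to reversal, a row letter m - 1 and a column letter
-- m have a further column letter below them. Adding a letter suitably gives a word containing
-- K(P); it is equivalent to a word in which too few letters descend from the copies of m.
module Submission where

open import Defs
open import Data.Empty using (⊥; ⊥-elim)
open import Data.Fin as Fin using (Fin; zero; suc; toℕ)
open import Data.Fin.Permutation using (Permutation′; _⟨$⟩ʳ_; _⟨$⟩ˡ_; inverseʳ; inverseˡ; cast-id; _∘ₚ_)
open import Data.Fin.Properties using (toℕ-cast; toℕ<n; toℕ-injective; toℕ-fromℕ<)
open import Data.List using (List; []; _∷_; [_]; _++_; map; length; concat; reverse; foldl; replicate; tabulate; applyUpTo; lookup; drop; alignWith; fromMaybe)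
open import Data.List.Membership.Propositional using (_∈_)
open import Data.List.Membership.Propositional.Properties using (∈-tabulate⁺; ∈-tabulate⁻; ∈-applyUpTo⁺; ∈-applyUpTo⁻; ∈-map⁺; ∈-++⁺ˡ; ∈-++⁺ʳ; ∈-++⁻)
open import Data.List.Membership.Propositional.Properties.WithK using (unique∧set⇒bag)
open import Data.List.Properties using (++-assoc; ++-identityʳ; concat-map-[_]; foldl-++; length-++; length-applyUpTo; length-map; length-reverse; lookup-applyUpTo; map-++; map-applyUpTo; map-id; map-tabulate; map-∘; reverse-++; reverse-involutive; reverse-map; tabulate-cong; tabulate-lookup; unfold-reverse; ∷-injective)
open import Data.List.Relation.Binary.BagAndSetEquality using (∼bag⇒↭)
open import Data.List.Relation.Binary.Permutation.Homogeneous using (onIndices)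
open import Data.List.Relation.Binary.Permutation.Propositional using (_↭_; ↭-refl; ↭-sym; ↭-trans; ↭-reflexive; ↭⇒↭ₛ; prep; swap)
open import Data.List.Relation.Binary.Permutation.Propositional.Properties as Permₚ using (∈-resp-↭)
open import Data.List.Relation.Binary.Pointwise using (Pointwise-≡⇒≡)
open import Data.List.Relation.Binary.Prefix.Heterogeneous using (Prefix; []; _∷_)
open import Data.List.Relation.Binary.Sublist.Heterogeneous.Properties using (length-mono-≤; toPointwise)
open import Data.List.Relation.Binary.Sublist.Propositional as Sublist using (_⊆_; []; _∷_; _∷ʳ_; ⊆-refl)
open import Data.List.Relation.Binary.Sublist.Propositional.Properties using (All-resp-⊆; reverse⁺)
open import Data.List.Relation.Unary.All as All using (All; []; _∷_)
open import Data.List.Relation.Unary.All.Properties as Allₚ using ()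
open import Data.List.Relation.Unary.AllPairs as AllPairs using (AllPairs; []; _∷_)
open import Data.List.Relation.Unary.AllPairs.Properties as AllPairsₚ using ()
open import Data.List.Relation.Unary.Any using (here; there)
open import Data.List.Relation.Unary.Linked as Linked using (Linked; []; [-]; _∷_)
open import Data.List.Relation.Unary.Linked.Properties using (Linked⇒AllPairs; AllPairs⇒Linked)
open import Data.List.Relation.Unary.Sorted.TotalOrder.Properties using (↗↭↗⇒≋)
open import Data.List.Relation.Unary.Unique.Propositional using (Unique)
open import Data.List.Relation.Unary.Unique.Propositional.Properties as Uniqueₚ using ()
open import Data.Maybe using (Maybe; just; nothing)
open import Data.Nat
open import Data.Nat.ListAction using (sum)
open import Data.Nat.Properties
open import Data.Product using (∃; ∃₂; _×_; _,_; proj₁; proj₂; map₁) renaming (swap to ×-swap)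
open import Data.Sum using (_⊎_; inj₁; inj₂)
open import Function
open import Level using (0ℓ)
open import Relation.Binary.Core using (Rel)
open import Relation.Binary.Definitions using (Transitive; tri<; tri≈; tri>)
open import Relation.Binary.PropositionalEquality hiding ([_])
open import Relation.Nullary
open import Relation.Unary using (Pred)
open import Data.List.Relation.Binary.Permutation.Setoid.Properties (setoid ℕ) using (Unique-resp-↭; onIndices-lookup)

-- Why both chains must grow: removing a letter of R other than the corner spares the first row or
-- the first column, while removing the corner shortens both, and a neighbour of the corner repairs
-- only one. So R has to exceed P in both directions, and the new letter must lie on an ascending
-- and on a descending chain at once. It is placed by means of the top left square a₁ a₂ / c₁ c₂,
-- just above the smaller of a₂ and c₁. For a hook that is not superstandard, the new letter goes in
-- front, with a value just below the raised row letter m - 1. It takes over the place of m before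
-- the column letters below m, so that m can slide behind them. A copy of the hook word within one
-- more letter leaves only two values for the copy of m: the raised m, which has moved, and the
-- raised m - 1, which stands in the row because m - 1 was a row letter. Neither is followed by a
-- long descent.

variable
  a b c d i j k l m n p q t v x y z : ℕ
  as cs r s u w xs : List ℕ
  ρ : ℕ → ℕ
  α α′ β : ℕ
  r′ u′ w′ s′ : List ℕ
  T T′ : Tableau
  o : Maybe ℕ

infix 4 _~_

-- Knuth equivalence of words.
data _~_ : List ℕ → List ℕ → Set where
  yxz   : x < y → y < z → y ∷ x ∷ z ∷ w ~ y ∷ z ∷ x ∷ w
  xzy   : x < y → y < z → x ∷ z ∷ y ∷ w ~ z ∷ x ∷ y ∷ w
  cons  : ∀ a → u ~ w → a ∷ u ~ a ∷ w
  rfl   : u ~ u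
  symm  : u ~ w → w ~ u
  _∙_   : u ~ s → s ~ w → u ~ w

infixr 5 _∙_

~-reflexive : u ≡ w → u ~ w
~-reflexive refl = rfl

~-++ˡ : ∀ xs → u ~ w → xs ++ u ~ xs ++ w
~-++ˡ []       e = e
~-++ˡ (x ∷ xs) e = cons x (~-++ˡ xs e)

~-++ʳ : u ~ w → u ++ xs ~ w ++ xs
~-++ʳ (yxz p q)  = yxz p q
~-++ʳ (xzy p q)  = xzy p q
~-++ʳ (cons a e) = cons a (~-++ʳ e)
~-++ʳ rfl        = rfl
~-++ʳ (symm e)   = symm (~-++ʳ e)
~-++ʳ (e ∙ f)    = ~-++ʳ e ∙ ~-++ʳ f

~⇒↭ : u ~ w → u ↭ w
~⇒↭ (yxz _ _)  = prep _ (swap _ _ ↭-refl)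
~⇒↭ (xzy _ _)  = swap _ _ ↭-refl
~⇒↭ (cons a e) = prep a (~⇒↭ e)
~⇒↭ rfl        = ↭-refl
~⇒↭ (symm e)   = ↭-sym (~⇒↭ e)
~⇒↭ (e ∙ f)    = ↭-trans (~⇒↭ e) (~⇒↭ f)

~-reverse : u ~ w → reverse u ~ reverse w
~-reverse {u = y ∷ x ∷ z ∷ w} (yxz p q)
  rewrite reverse-++ (y ∷ x ∷ z ∷ []) w | reverse-++ (y ∷ z ∷ x ∷ []) w
  = ~-++ˡ (reverse w) (symm (xzy p q))
~-reverse {u = x ∷ z ∷ y ∷ w} (xzy p q)
  rewrite reverse-++ (x ∷ z ∷ y ∷ []) w | reverse-++ (z ∷ x ∷ y ∷ []) w
  = ~-++ˡ (reverse w) (symm (yxz p q))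
~-reverse {u = _ ∷ u} {w = _ ∷ w} (cons a e)
  rewrite unfold-reverse a u | unfold-reverse a w = ~-++ʳ (~-reverse e)
~-reverse rfl      = rfl
~-reverse (symm e) = symm (~-reverse e)
~-reverse (e ∙ f)  = ~-reverse e ∙ ~-reverse f

StrictlyIncreasing : (ℕ → ℕ) → Set
StrictlyIncreasing ρ = ∀ {x y} → x < y → ρ x < ρ y

increasing⇒reflects-< : StrictlyIncreasing ρ → ρ x < ρ y → x < y
increasing⇒reflects-< {x = x} {y} ρ↗ lt with <-cmp x y
... | tri< p _ _    = p
... | tri≈ _ refl _ = ⊥-elim (<-irrefl refl lt)
... | tri> _ _ p    = ⊥-elim (<-asym lt (ρ↗ p))

~-map : StrictlyIncreasing ρ → u ~ w → map ρ u ~ map ρ w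
~-map ρ↗ (yxz p q)  = yxz (ρ↗ p) (ρ↗ q)
~-map ρ↗ (xzy p q)  = xzy (ρ↗ p) (ρ↗ q)
~-map ρ↗ (cons a e) = cons _ (~-map ρ↗ e)
~-map ρ↗ rfl        = rfl
~-map ρ↗ (symm e)   = symm (~-map ρ↗ e)
~-map ρ↗ (e ∙ f)    = ~-map ρ↗ e ∙ ~-map ρ↗ f

-- A move only compares letters, and an increasing map reflects comparisons. Both directions are
-- proved together because `symm` exchanges them.
~-unmap : StrictlyIncreasing ρ → u ~ w →
          (∀ u′ → u ≡ map ρ u′ → ∃ λ w′ → w ≡ map ρ w′ × u′ ~ w′) ×
          (∀ w′ → w ≡ map ρ w′ → ∃ λ u′ → u ≡ map ρ u′ × w′ ~ u′)
~-unmap {ρ} ρ↗ (yxz p q) =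
    (λ { (y ∷ x ∷ z ∷ w) refl → y ∷ z ∷ x ∷ w , refl , yxz (back p) (back q) })
  , (λ { (y ∷ z ∷ x ∷ w) refl → y ∷ x ∷ z ∷ w , refl , symm (yxz (back p) (back q)) })
  where
  back : ∀ {x y} → ρ x < ρ y → x < y
  back = increasing⇒reflects-< ρ↗
~-unmap {ρ} ρ↗ (xzy p q) =
    (λ { (x ∷ z ∷ y ∷ w) refl → z ∷ x ∷ y ∷ w , refl , xzy (back p) (back q) })
  , (λ { (z ∷ x ∷ y ∷ w) refl → x ∷ z ∷ y ∷ w , refl , symm (xzy (back p) (back q)) })
  where
  back : ∀ {x y} → ρ x < ρ y → x < y
  back = increasing⇒reflects-< ρ↗
~-unmap ρ↗ (cons a e) =
    (λ { (x ∷ u′) refl → let w′ , eq , f = proj₁ (~-unmap ρ↗ e) u′ refl in x ∷ w′ , cong (_ ∷_) eq , cons x f })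
  , (λ { (x ∷ w′) refl → let u′ , eq , f = proj₂ (~-unmap ρ↗ e) w′ refl in x ∷ u′ , cong (_ ∷_) eq , cons x f })
~-unmap ρ↗ rfl      = (λ u′ eq → u′ , eq , rfl) , (λ u′ eq → u′ , eq , rfl)
~-unmap ρ↗ (symm e) = ×-swap (~-unmap ρ↗ e)
~-unmap ρ↗ (e ∙ f) =
    (λ u′ eq → let s′ , eq₁ , g = proj₁ (~-unmap ρ↗ e) u′ eq
                   w′ , eq₂ , h = proj₁ (~-unmap ρ↗ f) s′ eq₁ in w′ , eq₂ , g ∙ h)
  , (λ w′ eq → let s′ , eq₁ , g = proj₂ (~-unmap ρ↗ f) w′ eq
                   u′ , eq₂ , h = proj₂ (~-unmap ρ↗ e) s′ eq₁ in u′ , eq₂ , g ∙ h)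

-- Ascending and descending chains under Knuth moves

-- An R-chain of length k among the letters of a word, all of them R-after b.
data Chain (R : Rel ℕ 0ℓ) : ℕ → ℕ → List ℕ → Set where
  []   : Chain R zero b w
  _∷_  : R b x → Chain R k x w → Chain R (suc k) b (x ∷ w)
  skip : Chain R k b w → Chain R k b (x ∷ w)

Has : Rel ℕ 0ℓ → ℕ → List ℕ → Set
Has R k w = ∃ λ b → Chain R k b w

chain-map : ∀ {R : Rel ℕ 0ℓ} → (∀ {x y} → R x y → R (ρ x) (ρ y)) → Chain R k b w → Chain R k (ρ b) (map ρ w)
chain-map f []       = []
chain-map f (x ∷ c)  = f x ∷ chain-map f c
chain-map f (skip c) = skip (chain-map f c)

chain-unmap : ∀ {R : Rel ℕ 0ℓ} → (∀ {x y} → R (ρ x) (ρ y) → R x y) → Chain R k (ρ b) (map ρ w) → Chain R k b w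
chain-unmap {ρ} {R = R} f = go refl refl
  where
  go : ∀ {b w b′ w′} → b′ ≡ ρ b → w′ ≡ map ρ w → Chain R k b′ w′ → Chain R k b w
  go _ _ []                          = []
  go {w = _ ∷ _} refl refl (x ∷ c)  = f x ∷ go refl refl c
  go {w = _ ∷ _} eq   refl (skip c) = skip (go eq refl c)

module _ {R : Rel ℕ 0ℓ} where

  chain-⊆ : u ⊆ w → Chain R k b u → Chain R k b w
  chain-⊆ s           []       = []
  chain-⊆ (refl ∷ s)  (x ∷ c)  = x ∷ chain-⊆ s c
  chain-⊆ (refl ∷ s)  (skip c) = skip (chain-⊆ s c)
  chain-⊆ (_ ∷ʳ s)    c        = skip (chain-⊆ s c)

  chain-++ˡ : ∀ u → Chain R k b w → Chain R k b (u ++ w)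
  chain-++ˡ []      c = c
  chain-++ˡ (_ ∷ u) c = skip (chain-++ˡ u c)

  chain-++ʳ : Chain R k b u → Chain R k b (u ++ w)
  chain-++ʳ []       = []
  chain-++ʳ (x ∷ c)  = x ∷ chain-++ʳ c
  chain-++ʳ (skip c) = skip (chain-++ʳ c)

  chain-rebase : All (R a) w → Chain R k b w → Chain R k a w
  chain-rebase _        []       = []
  chain-rebase (r ∷ _)  (_ ∷ c)  = r ∷ c
  chain-rebase (_ ∷ rs) (skip c) = skip (chain-rebase rs c)

  module _ (tr : Transitive R) where

    chain-weaken : R a b → Chain R k b w → Chain R k a w
    chain-weaken r []       = []
    chain-weaken r (x ∷ c)  = tr r x ∷ c
    chain-weaken r (skip c) = skip (chain-weaken r c)

    chain-drop : Chain R (suc k) b w → Chain R k b w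
    chain-drop (x ∷ c)  = skip (chain-weaken x c)
    chain-drop (skip c) = skip (chain-drop c)

    module _ (irr : ∀ {x} → ¬ R x x) (x<y : R x y) (y<z : R y z) where

      private
        asym : R a b → ¬ R b a
        asym p q = irr (tr p q)

      -- When xz is used, replace it by yz.
      chain-yxz⇒yzx : Chain R k b (y ∷ x ∷ z ∷ w) → Chain R k b (y ∷ z ∷ x ∷ w)
      chain-yxz⇒yzx [] = []
      chain-yxz⇒yzx (p ∷ [])              = p ∷ []
      chain-yxz⇒yzx (_ ∷ (p ∷ _))         = ⊥-elim (asym x<y p)
      chain-yxz⇒yzx (p ∷ skip [])         = p ∷ []
      chain-yxz⇒yzx (p ∷ skip (q ∷ c))    = p ∷ q ∷ skip c
      chain-yxz⇒yzx (p ∷ skip (skip c))   = p ∷ skip (skip c)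
      chain-yxz⇒yzx (skip [])             = []
      chain-yxz⇒yzx (skip (p ∷ []))       = skip (skip (p ∷ []))
      chain-yxz⇒yzx (skip (p ∷ q ∷ c))    = tr p x<y ∷ y<z ∷ skip c
      chain-yxz⇒yzx (skip (p ∷ skip c))   = skip (skip (p ∷ c))
      chain-yxz⇒yzx (skip (skip []))      = []
      chain-yxz⇒yzx (skip (skip (p ∷ c))) = skip (p ∷ skip c)
      chain-yxz⇒yzx (skip (skip (skip c))) = skip (skip (skip c))

      chain-yzx⇒yxz : Chain R k b (y ∷ z ∷ x ∷ w) → Chain R k b (y ∷ x ∷ z ∷ w)
      chain-yzx⇒yxz [] = []
      chain-yzx⇒yxz (p ∷ [])              = p ∷ []
      chain-yzx⇒yxz (p ∷ q ∷ [])          = p ∷ skip (q ∷ [])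
      chain-yzx⇒yxz (p ∷ q ∷ r ∷ c)       = ⊥-elim (asym (tr x<y y<z) r)
      chain-yzx⇒yxz (p ∷ q ∷ skip c)      = p ∷ skip (q ∷ c)
      chain-yzx⇒yxz (p ∷ skip [])         = p ∷ []
      chain-yzx⇒yxz (p ∷ skip (q ∷ c))    = ⊥-elim (asym x<y q)
      chain-yzx⇒yxz (p ∷ skip (skip c))   = p ∷ skip (skip c)
      chain-yzx⇒yxz (skip [])             = []
      chain-yzx⇒yxz (skip (p ∷ []))       = skip (skip (p ∷ []))
      chain-yzx⇒yxz (skip (p ∷ q ∷ c))    = ⊥-elim (asym (tr x<y y<z) q)
      chain-yzx⇒yxz (skip (p ∷ skip c))   = skip (skip (p ∷ c))
      chain-yzx⇒yxz (skip (skip []))      = []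
      chain-yzx⇒yxz (skip (skip (p ∷ c))) = skip (p ∷ skip c)
      chain-yzx⇒yxz (skip (skip (skip c))) = skip (skip (skip c))

      -- When xz is used, replace it by xy.
      chain-xzy⇒zxy : Chain R k b (x ∷ z ∷ y ∷ w) → Chain R k b (z ∷ x ∷ y ∷ w)
      chain-xzy⇒zxy [] = []
      chain-xzy⇒zxy (p ∷ [])              = skip (p ∷ [])
      chain-xzy⇒zxy (p ∷ q ∷ [])          = skip (p ∷ x<y ∷ [])
      chain-xzy⇒zxy (p ∷ q ∷ r ∷ c)       = ⊥-elim (asym y<z r)
      chain-xzy⇒zxy (p ∷ q ∷ skip c)      = skip (p ∷ x<y ∷ chain-weaken y<z c)
      chain-xzy⇒zxy (p ∷ skip c)          = skip (p ∷ c)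
      chain-xzy⇒zxy (skip [])             = []
      chain-xzy⇒zxy (skip (p ∷ c))        = p ∷ skip c
      chain-xzy⇒zxy (skip (skip c))       = skip (skip c)

      chain-zxy⇒xzy : Chain R k b (z ∷ x ∷ y ∷ w) → Chain R k b (x ∷ z ∷ y ∷ w)
      chain-zxy⇒xzy [] = []
      chain-zxy⇒xzy (p ∷ [])              = skip (p ∷ [])
      chain-zxy⇒xzy (p ∷ q ∷ c)           = ⊥-elim (asym (tr x<y y<z) q)
      chain-zxy⇒xzy (p ∷ skip c)          = skip (p ∷ c)
      chain-zxy⇒xzy (skip [])             = []
      chain-zxy⇒xzy (skip (p ∷ c))        = p ∷ skip c
      chain-zxy⇒xzy (skip (skip c))       = skip (skip c)

>-trans : Transitive _>_
>-trans p q = <-trans q p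

<-irr : ¬ x < x
<-irr = <-irrefl refl

-- The bound b is preserved along with the length k. This is what lets the induction pass under
-- `cons`, where the head letter may become the new bound.
chain-<-~ : u ~ w → (∀ {k b} → Chain _<_ k b u → Chain _<_ k b w) × (∀ {k b} → Chain _<_ k b w → Chain _<_ k b u)
chain-<-~ (yxz p q)  = chain-yxz⇒yzx <-trans <-irr p q , chain-yzx⇒yxz <-trans <-irr p q
chain-<-~ (xzy p q)  = chain-xzy⇒zxy <-trans <-irr p q , chain-zxy⇒xzy <-trans <-irr p q
chain-<-~ (cons a e) = under (proj₁ (chain-<-~ e)) , under (proj₂ (chain-<-~ e))
  where
  under : (∀ {k b} → Chain _<_ k b u → Chain _<_ k b w) → Chain _<_ k b (a ∷ u) → Chain _<_ k b (a ∷ w)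
  under f []       = []
  under f (p ∷ c)  = p ∷ f c
  under f (skip c) = skip (f c)
chain-<-~ rfl        = id , id
chain-<-~ (symm e)   = ×-swap (chain-<-~ e)
chain-<-~ (e ∙ f)    = (λ c → proj₁ (chain-<-~ f) (proj₁ (chain-<-~ e) c)) , (λ c → proj₂ (chain-<-~ e) (proj₂ (chain-<-~ f) c))

-- For `_>_` the letters x and z exchange their roles, so each move is handled by the lemma that
-- treats its inverse for `_<_`.
chain->-~ : u ~ w → (∀ {k b} → Chain _>_ k b u → Chain _>_ k b w) × (∀ {k b} → Chain _>_ k b w → Chain _>_ k b u)
chain->-~ (yxz p q)  = chain-yzx⇒yxz >-trans <-irr q p , chain-yxz⇒yzx >-trans <-irr q p
chain->-~ (xzy p q)  = chain-zxy⇒xzy >-trans <-irr q p , chain-xzy⇒zxy >-trans <-irr q p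
chain->-~ (cons a e) = under (proj₁ (chain->-~ e)) , under (proj₂ (chain->-~ e))
  where
  under : (∀ {k b} → Chain _>_ k b u → Chain _>_ k b w) → Chain _>_ k b (a ∷ u) → Chain _>_ k b (a ∷ w)
  under f []       = []
  under f (p ∷ c)  = p ∷ f c
  under f (skip c) = skip (f c)
chain->-~ rfl        = id , id
chain->-~ (symm e)   = ×-swap (chain->-~ e)
chain->-~ (e ∙ f)    = (λ c → proj₁ (chain->-~ f) (proj₁ (chain->-~ e) c)) , (λ c → proj₂ (chain->-~ e) (proj₂ (chain->-~ f) c))

-- Row insertion

-- The graph of `bump`: inductions can follow its derivations instead of repeating the comparisons.
data Bump (x : ℕ) : List ℕ → List ℕ → Maybe ℕ → Set where
  end  : Bump x [] [ x ] nothing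
  hit  : x < y → Bump x (y ∷ r) (x ∷ r) (just y)
  pass : y ≤ x → Bump x r r′ o → Bump x (y ∷ r) (y ∷ r′) o

bump-total : ∀ x r → ∃₂ λ r′ o → Bump x r r′ o
bump-total x []      = _ , _ , end
bump-total x (y ∷ r) with x <? y
... | yes p = _ , _ , hit p
... | no ¬p = let _ , _ , b = bump-total x r in _ , _ , pass (≮⇒≥ ¬p) b

bump-computes : Bump x r r′ o → bump x r ≡ (r′ , o)
bump-computes end = refl
bump-computes {x} (hit {y} p) with x <? y
... | yes _ = refl
... | no ¬p = ⊥-elim (¬p p)
bump-computes {x} (pass {y} p b) with x <? y
... | yes q = ⊥-elim (≤⇒≯ p q)
... | no _  = cong (map₁ (y ∷_)) (bump-computes b)

←-add : Bump x r r′ nothing → (r ∷ T) ← x ≡ r′ ∷ T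
←-add {x} {r} b with bump x r | bump-computes b
... | _ | refl = refl

←-bump : Bump x r r′ (just y) → (r ∷ T) ← x ≡ r′ ∷ (T ← y)
←-bump {x} {r} b with bump x r | bump-computes b
... | _ | refl = refl

bump-> : Bump x r r′ (just y) → x < y
bump-> (hit p)    = p
bump-> (pass _ b) = bump-> b

bump-All : ∀ {P : Pred ℕ 0ℓ} → P x → All P r → Bump x r r′ o → All P r′
bump-All px []         end        = px ∷ []
bump-All px (_ ∷ ps)   (hit _)    = px ∷ ps
bump-All px (p ∷ ps)   (pass _ b) = p ∷ bump-All px ps b

bump-All-out : ∀ {P : Pred ℕ 0ℓ} → All P r → Bump x r r′ (just y) → P y
bump-All-out (p ∷ _)  (hit _)    = p
bump-All-out (_ ∷ ps) (pass _ b) = bump-All-out ps b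

Sorted : List ℕ → Set
Sorted = AllPairs _≤_

bump-sorted : Sorted r → Bump x r r′ o → Sorted r′
bump-sorted []       end        = [] ∷ []
bump-sorted (a ∷ s)  (hit p)    = All.map (≤-trans (<⇒≤ p)) a ∷ s
bump-sorted (a ∷ s)  (pass p b) = bump-All p a b ∷ bump-sorted s b

-- Inserting a word into a row r yields r′ and bumps w′ out into the next row.
data RowInsert : List ℕ → List ℕ → List ℕ → List ℕ → Set where
  done : RowInsert r [] r []
  add  : Bump x r s nothing  → RowInsert s w r′ w′ → RowInsert r (x ∷ w) r′ w′
  out  : Bump x r s (just y) → RowInsert s w r′ w′ → RowInsert r (x ∷ w) r′ (y ∷ w′)

rowInsert-total : ∀ r w → ∃₂ λ r′ w′ → RowInsert r w r′ w′
rowInsert-total r []      = _ , _ , done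
rowInsert-total r (x ∷ w) with bump-total x r
... | s , nothing , b = let _ , _ , i = rowInsert-total s w in _ , _ , add b i
... | s , just _  , b = let _ , _ , i = rowInsert-total s w in _ , _ , out b i

rowInsert-pass : All (x ≤_) w → RowInsert r w r′ w′ → RowInsert (x ∷ r) w (x ∷ r′) w′
rowInsert-pass []       done      = done
rowInsert-pass (p ∷ ps) (add b i) = add (pass p b) (rowInsert-pass ps i)
rowInsert-pass (p ∷ ps) (out b i) = out (pass p b) (rowInsert-pass ps i)

foldl-←-row : RowInsert r w r′ w′ → foldl _←_ (r ∷ T) w ≡ r′ ∷ foldl _←_ T w′
foldl-←-row done = refl
foldl-←-row {w = x ∷ w} {T = T} (add b i) = trans (cong (λ T → foldl _←_ T w) (←-add {T = T} b)) (foldl-←-row i)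
foldl-←-row {w = x ∷ w} {T = T} (out b i) = trans (cong (λ T → foldl _←_ T w) (←-bump {T = T} b)) (foldl-←-row i)

-- The weak inequalities are needed because a bumped-out letter may equal its neighbours.
data WeakMove : List ℕ → List ℕ → Set where
  same : WeakMove u u
  yxz  : x < y → y ≤ z → WeakMove (y ∷ x ∷ z ∷ []) (y ∷ z ∷ x ∷ [])
  xzy  : x ≤ y → y < z → WeakMove (x ∷ z ∷ y ∷ []) (z ∷ x ∷ y ∷ [])
  symm : WeakMove u w → WeakMove w u

bump-twice-≤ : Sorted r → y ≤ z → Bump y r s nothing → Bump z s r′ o → o ≡ nothing
bump-twice-≤ _       y≤z end        (pass _ end)  = refl
bump-twice-≤ _       y≤z end        (hit z<y)     = ⊥-elim (≤⇒≯ y≤z z<y)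
bump-twice-≤ _       y≤z (pass p b) (hit z<h)     = ⊥-elim (≤⇒≯ (≤-trans p y≤z) z<h)
bump-twice-≤ (_ ∷ s) y≤z (pass p b) (pass _ b′)   = bump-twice-≤ s y≤z b b′

bump-twice-mono : Sorted r → y ≤ z → Bump y r s (just a) → Bump z s r′ (just b) → a ≤ b
bump-twice-mono (al ∷ s) y≤z (hit p)    (hit z<y)   = ⊥-elim (≤⇒≯ y≤z z<y)
bump-twice-mono (al ∷ s) y≤z (hit p)    (pass _ b′) = bump-All-out al b′
bump-twice-mono (al ∷ s) y≤z (pass p b) (hit z<h)   = ⊥-elim (≤⇒≯ (≤-trans p y≤z) z<h)
bump-twice-mono (al ∷ s) y≤z (pass p b) (pass _ b′) = bump-twice-mono s y≤z b b′

-- Once z has been inserted, the row has an entry larger than y, so y bumps something; the entries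
-- before z are at most z.
bump-after-larger : y < z → Bump z r s o → ∃₂ λ r′ a → Bump y s r′ (just a) × a ≤ z
bump-after-larger {y} y<z end     = _ , _ , hit y<z , ≤-refl
bump-after-larger {y} y<z (hit p) = _ , _ , hit y<z , ≤-refl
bump-after-larger {y} y<z (pass {h} p b) with y <? h
... | yes y<h = _ , _ , hit y<h , p
... | no  y≮h = let _ , _ , b′ , q = bump-after-larger y<z b in _ , _ , pass (≮⇒≥ y≮h) b′ , q

-- Both words leave the same row behind, and what they bump out again differs by at most one weak
-- move; hence an induction over the rows shows that the tableaux agree. The cases compare the
-- letters with the head h of the row.
rowInsert-weakMove : Sorted r → WeakMove u w →
  ∃ λ r′ → ∃₂ λ u′ w′ → RowInsert r u r′ u′ × RowInsert r w r′ w′ × WeakMove u′ w′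
rowInsert-weakMove {r} {u} _ same = let _ , _ , i = rowInsert-total r u in _ , _ , _ , i , i , same
rowInsert-weakMove [] (yxz x<y y≤z) =
  _ , _ , _ , add end (out (hit x<y) (add (pass (≤-trans (<⇒≤ x<y) y≤z) end) done))
            , add end (add (pass y≤z end) (out (hit x<y) done)) , same
rowInsert-weakMove {h ∷ t} (al ∷ s) (yxz {x} {y} {z} x<y y≤z) with x <? h | y <? h
... | no x≮h | _ =
  let h≤x = ≮⇒≥ x≮h
      h≤y = ≤-trans h≤x (<⇒≤ x<y)
      h≤z = ≤-trans h≤y y≤z
      _ , _ , _ , i , j , m = rowInsert-weakMove s (yxz x<y y≤z)
  in _ , _ , _ , rowInsert-pass (h≤y ∷ h≤x ∷ h≤z ∷ []) i , rowInsert-pass (h≤y ∷ h≤z ∷ h≤x ∷ []) j , m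
... | yes x<h | yes y<h with bump-total z t
...   | _ , nothing , b =
  _ , _ , _ , out (hit y<h) (out (hit x<y) (add (pass x≤z b) done))
            , out (hit y<h) (add (pass y≤z b) (out (hit x<y) done)) , same
  where x≤z = ≤-trans (<⇒≤ x<y) y≤z
...   | _ , just _ , b =
  _ , _ , _ , out (hit y<h) (out (hit x<y) (out (pass x≤z b) done))
            , out (hit y<h) (out (pass y≤z b) (out (hit x<y) done)) , yxz y<h (bump-All-out al b)
  where x≤z = ≤-trans (<⇒≤ x<y) y≤z
rowInsert-weakMove {h ∷ t} (al ∷ s) (yxz {x} {y} {z} x<y y≤z) | yes x<h | no y≮h with bump-total y t
... | t₁ , oy , by with bump-total z t₁
...   | t₂ , oz , bz with oy | oz
...     | nothing | just _ = case bump-twice-≤ s y≤z by bz of λ ()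
...     | nothing | nothing =
  _ , _ , _ , add (pass h≤y by) (out (hit x<h) (add (pass x≤z bz) done))
            , add (pass h≤y by) (add (pass h≤z bz) (out (hit x<h) done)) , same
  where
  h≤y = ≮⇒≥ y≮h
  h≤z = ≤-trans h≤y y≤z
  x≤z = ≤-trans (<⇒≤ x<y) y≤z
...     | just _ | nothing =
  _ , _ , _ , out (pass h≤y by) (out (hit x<h) (add (pass x≤z bz) done))
            , out (pass h≤y by) (add (pass h≤z bz) (out (hit x<h) done)) , same
  where
  h≤y = ≮⇒≥ y≮h
  h≤z = ≤-trans h≤y y≤z
  x≤z = ≤-trans (<⇒≤ x<y) y≤z
...     | just _ | just _ =
  _ , _ , _ , out (pass h≤y by) (out (hit x<h) (out (pass x≤z bz) done))
            , out (pass h≤y by) (out (pass h≤z bz) (out (hit x<h) done))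
            , yxz (≤-<-trans h≤y (bump-> by)) (bump-twice-mono s y≤z by bz)
  where
  h≤y = ≮⇒≥ y≮h
  h≤z = ≤-trans h≤y y≤z
  x≤z = ≤-trans (<⇒≤ x<y) y≤z
rowInsert-weakMove [] (xzy x≤y y<z) =
  _ , _ , _ , add end (add (pass (<⇒≤ x<z) end) (out (pass x≤y (hit y<z)) done))
            , add end (out (hit x<z) (add (pass x≤y end) done)) , same
  where x<z = ≤-<-trans x≤y y<z
rowInsert-weakMove {h ∷ t} (al ∷ s) (xzy {x} {y} {z} x≤y y<z) with x <? h | z <? h
... | no x≮h | _ =
  let h≤x = ≮⇒≥ x≮h
      h≤y = ≤-trans h≤x x≤y
      h≤z = ≤-trans h≤y (<⇒≤ y<z)
      _ , _ , _ , i , j , m = rowInsert-weakMove s (xzy x≤y y<z)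
  in _ , _ , _ , rowInsert-pass (h≤x ∷ h≤z ∷ h≤y ∷ []) i , rowInsert-pass (h≤z ∷ h≤x ∷ h≤y ∷ []) j , m
... | yes x<h | no z≮h with bump-total z t
...   | t₁ , oz , bz with bump-after-larger y<z bz
...     | t₂ , a , by , a≤z with oz
...       | nothing =
  _ , _ , _ , out (hit x<h) (add (pass (<⇒≤ (≤-<-trans x≤y y<z)) bz) (out (pass x≤y by) done))
            , add (pass (≮⇒≥ z≮h) bz) (out (hit x<h) (out (pass x≤y by) done)) , same
...       | just _ =
  _ , _ , _ , out (hit x<h) (out (pass (<⇒≤ (≤-<-trans x≤y y<z)) bz) (out (pass x≤y by) done))
            , out (pass (≮⇒≥ z≮h) bz) (out (hit x<h) (out (pass x≤y by) done))
            , xzy (bump-All-out (bump-All (≮⇒≥ z≮h) al bz) by) (≤-<-trans a≤z (bump-> bz))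
rowInsert-weakMove {h ∷ []} (al ∷ s) (xzy {x} {y} {z} x≤y y<z) | yes x<h | yes z<h =
  _ , _ , _ , out (hit x<h) (add (pass (<⇒≤ x<z) end) (out (pass x≤y (hit y<z)) done))
            , out (hit z<h) (out (hit x<z) (add (pass x≤y end) done)) , same
  where x<z = ≤-<-trans x≤y y<z
-- Here the kind of move changes: h g z and h z g are bumped out, and z < h ≤ g makes them a `yxz`
-- pair.
rowInsert-weakMove {h ∷ g ∷ t} ((h≤g ∷ al) ∷ s) (xzy {x} {y} {z} x≤y y<z) | yes x<h | yes z<h =
  _ , _ , _ , out (hit x<h) (out (pass (<⇒≤ x<z) (hit z<g)) (out (pass x≤y (hit y<z)) done))
            , out (hit z<h) (out (hit x<z) (out (pass x≤y (hit (<-trans y<z z<g))) done)) , symm (yxz z<h h≤g)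
  where
  x<z = ≤-<-trans x≤y y<z
  z<g = <-≤-trans z<h h≤g
rowInsert-weakMove s (symm m) =
  let _ , _ , _ , i , j , m′ = rowInsert-weakMove s m in _ , _ , _ , j , i , symm m′

ins : List ℕ → Tableau
ins = foldl _←_ []

foldl-weakMove : All Sorted T → WeakMove u w → foldl _←_ T u ≡ foldl _←_ T w
foldl-weakMove _ same                    = refl
foldl-weakMove ss (symm m)               = sym (foldl-weakMove ss m)
-- The first letter turns the empty tableau and a single empty row into the same tableau, so the row
-- lemma applies to the row `[]`.
foldl-weakMove [] (yxz p q)              =
  let _ , _ , _ , i , j , _ = rowInsert-weakMove [] (yxz p q)
  in trans (foldl-←-row i) (sym (foldl-←-row j))
foldl-weakMove [] (xzy p q)              =
  let _ , _ , _ , i , j , _ = rowInsert-weakMove [] (xzy p q)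
  in trans (foldl-←-row i) (sym (foldl-←-row j))
foldl-weakMove {r ∷ T} {u} {w} (s ∷ ss) m =
  let r′ , _ , _ , i , j , m′ = rowInsert-weakMove s m
  in trans (foldl-←-row i) (trans (cong (r′ ∷_) (foldl-weakMove ss m′)) (sym (foldl-←-row j)))

←-sorted : ∀ x → All Sorted T → All Sorted (T ← x)
←-sorted x [] = ([] ∷ []) ∷ []
←-sorted {r ∷ T} x (s ∷ ss) with bump-total x r
... | r′ , nothing , b rewrite ←-add {T = T} b  = bump-sorted s b ∷ ss
... | r′ , just y  , b rewrite ←-bump {T = T} b = bump-sorted s b ∷ ←-sorted y ss

foldl-←-sorted : ∀ w → All Sorted T → All Sorted (foldl _←_ T w)
foldl-←-sorted []      ss = ss
foldl-←-sorted (x ∷ w) ss = foldl-←-sorted w (←-sorted x ss)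

foldl-←-~ : All Sorted T → u ~ w → foldl _←_ T u ≡ foldl _←_ T w
foldl-←-~ ss (yxz {w = w} p q) = cong (λ T → foldl _←_ T w) (foldl-weakMove ss (yxz p (<⇒≤ q)))
foldl-←-~ ss (xzy {w = w} p q) = cong (λ T → foldl _←_ T w) (foldl-weakMove ss (xzy (<⇒≤ p) q))
foldl-←-~ ss (cons a e)        = foldl-←-~ (←-sorted a ss) e
foldl-←-~ ss rfl               = refl
foldl-←-~ ss (symm e)          = sym (foldl-←-~ ss e)
foldl-←-~ ss (e ∙ f)           = trans (foldl-←-~ ss e) (foldl-←-~ ss f)

ins-~ : u ~ w → ins u ≡ ins w
ins-~ = foldl-←-~ []

-- Reading words, and insertion as an operation on tableaux

reading : Tableau → List ℕ
reading []       = []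
reading (r ∷ T) = reading T ++ r

Strict : List ℕ → Set
Strict = AllPairs _<_

Below : List ℕ → List ℕ → Set
Below = flip (Prefix _>_)

record IsTableau (T : Tableau) : Set where
  constructor tableau
  field
    nonempty : All (_≢ []) T
    strict   : All Strict T
    below    : Linked Below T

tableau-tail : IsTableau (r ∷ T) → IsTableau T
tableau-tail (tableau (_ ∷ ne) (_ ∷ st) be) = tableau ne st (Linked.tail be)

-- Each entry of r bumps the entry of `cs` directly below it, and the entries beyond the end of `cs`
-- are appended. So a row inserted into the tableau below it pushes every row down by one, and the
-- reading word rebuilds its tableau.
rowInsert-above : Strict r → Prefix _>_ cs r → RowInsert cs r r cs
rowInsert-above {[]}     _         []      = done
rowInsert-above {a ∷ as} (al ∷ st) []      = add end (rowInsert-pass (All.map <⇒≤ al) (rowInsert-above st []))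
rowInsert-above {a ∷ as} (al ∷ st) (p ∷ q) = out (hit p) (rowInsert-pass (All.map <⇒≤ al) (rowInsert-above st q))

foldl-←-tableau : IsTableau (r ∷ T) → foldl _←_ T r ≡ r ∷ T
foldl-←-tableau {r = []}               (tableau (ne ∷ _) _ _) = ⊥-elim (ne refl)
foldl-←-tableau {r = _ ∷ _} {T = []}    (tableau _ (st ∷ _) _) = foldl-←-row {T = []} (rowInsert-above st [])
foldl-←-tableau {r = r} {T = c ∷ T} t@(tableau _ (st ∷ _) (be ∷ _)) =
  trans (foldl-←-row (rowInsert-above st be)) (cong (r ∷_) (foldl-←-tableau (tableau-tail t)))

ins-reading : IsTableau T → ins (reading T) ≡ T
ins-reading {[]}    _ = refl
ins-reading {r ∷ T} t = trans (foldl-++ _←_ [] (reading T) r)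
  (trans (cong (λ S → foldl _←_ S r) (ins-reading (tableau-tail t))) (foldl-←-tableau t))

bump-↭ : Bump x r r′ o → x ∷ r ↭ fromMaybe o ++ r′
bump-↭ end        = ↭-refl
bump-↭ (hit _)    = swap _ _ ↭-refl
bump-↭ {x} (pass {y = y} {o = nothing} _ b) = ↭-trans (swap x y ↭-refl) (prep y (bump-↭ b))
bump-↭ {x} (pass {y = y} {o = just z} _ b)  = ↭-trans (swap x y ↭-refl) (↭-trans (prep y (bump-↭ b)) (swap y z ↭-refl))

concat-←-↭ : ∀ T x → concat (T ← x) ↭ x ∷ concat T
concat-←-↭ []      x = ↭-refl
concat-←-↭ (r ∷ T) x with bump-total x r
... | r′ , nothing , b rewrite ←-add {T = T} b  = Permₚ.++⁺ʳ (concat T) (↭-sym (bump-↭ b))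
... | r′ , just y  , b rewrite ←-bump {T = T} b =
  ↭-trans (Permₚ.++⁺ˡ r′ (concat-←-↭ T y))
    (↭-trans (Permₚ.shift y r′ (concat T)) (Permₚ.++⁺ʳ (concat T) (↭-sym (bump-↭ b))))

concat-foldl-←-↭ : ∀ T w → concat (foldl _←_ T w) ↭ w ++ concat T
concat-foldl-←-↭ T []      = ↭-refl
concat-foldl-←-↭ T (x ∷ w) =
  ↭-trans (concat-foldl-←-↭ (T ← x) w) (↭-trans (Permₚ.++⁺ˡ w (concat-←-↭ T x)) (Permₚ.shift x w (concat T)))

concat-ins-↭ : ∀ w → concat (ins w) ↭ w
concat-ins-↭ w = ↭-trans (concat-foldl-←-↭ [] w) (↭-reflexive (++-identityʳ w))

reading-↭ : ∀ T → reading T ↭ concat T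
reading-↭ []      = ↭-refl
reading-↭ (r ∷ T) = ↭-trans (Permₚ.++⁺ʳ r (reading-↭ T)) (Permₚ.++-comm (concat T) r)

bump-nonempty : Bump x r r′ o → r′ ≢ []
bump-nonempty end        ()
bump-nonempty (hit _)    ()
bump-nonempty (pass _ _) ()

←-nonempty : ∀ x → All (_≢ []) T → All (_≢ []) (T ← x)
←-nonempty x [] = (λ ()) ∷ []
←-nonempty {r ∷ T} x (_ ∷ ne) with bump-total x r
... | r′ , nothing , b rewrite ←-add {T = T} b  = bump-nonempty b ∷ ne
... | r′ , just y  , b rewrite ←-bump {T = T} b = bump-nonempty b ∷ ←-nonempty y ne

bump-prefix : Prefix _>_ cs r → Bump x r r′ o → Prefix _>_ cs r′
bump-prefix []      _          = []
bump-prefix (p ∷ q) (hit x<h)  = <-trans x<h p ∷ q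
bump-prefix (p ∷ q) (pass _ b) = p ∷ bump-prefix q b

bump-head : Bump x r r′ (just y) → Prefix _>_ [ y ] r′
bump-head (hit p)    = p ∷ []
bump-head (pass p b) = ≤-<-trans p (bump-> b) ∷ []

-- The letter y enters the lower row weakly to the left of the place it left, because the entry
-- below that place, if any, exceeds y. Above its new place stands x or an entry at most x, which is
-- smaller than y.
bump-below : Below r cs → Bump x r r′ (just y) → Bump y cs s o → Below r′ s
bump-below []      b          end         = bump-head b
bump-below (g>h ∷ q) (hit x<h)   (hit h<g)   = x<h ∷ q
bump-below (g>h ∷ q) (hit x<h)   (pass g≤h _) = ⊥-elim (≤⇒≯ g≤h g>h)
bump-below (g>h ∷ q) (pass h≤x b) (hit y<g)  = ≤-<-trans h≤x (bump-> b) ∷ bump-prefix q b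
bump-below (g>h ∷ q) (pass h≤x b) (pass _ b′) = g>h ∷ bump-below q b b′

below-replaceHead : Bump x r r′ o → Linked Below (r ∷ T) → Linked Below (r′ ∷ T)
below-replaceHead b [-]      = [-]
below-replaceHead b (q ∷ be) = bump-prefix q b ∷ be

←-below : Linked Below (r ∷ T) → Bump x r r′ (just y) → Linked Below (r′ ∷ (T ← y))
←-below {T = []}    _        b = bump-head b ∷ [-]
←-below {T = c ∷ T} {y = y} (p ∷ be) b with bump-total y c
... | c′ , nothing , b′ rewrite ←-add {T = T} b′  = bump-below p b b′ ∷ below-replaceHead b′ be
... | c′ , just _  , b′ rewrite ←-bump {T = T} b′ = bump-below p b b′ ∷ ←-below be b′

insert-below : ∀ x → Linked Below T → Linked Below (T ← x)
insert-below {[]}    x _ = [-]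
insert-below {r ∷ T} x be with bump-total x r
... | r′ , just _  , b rewrite ←-bump {T = T} b = ←-below be b
... | r′ , nothing , b rewrite ←-add {T = T} b  = below-replaceHead b be

allPairs-++ˡ : ∀ {R : Rel ℕ 0ℓ} u → AllPairs R (u ++ w) → AllPairs R u
allPairs-++ˡ []      _         = []
allPairs-++ˡ (x ∷ u) (al ∷ ps) = Allₚ.++⁻ˡ u al ∷ allPairs-++ˡ u ps

allPairs-++ʳ : ∀ {R : Rel ℕ 0ℓ} u → AllPairs R (u ++ w) → AllPairs R w
allPairs-++ʳ []      ps       = ps
allPairs-++ʳ (x ∷ u) (_ ∷ ps) = allPairs-++ʳ u ps

unique-disjoint : ∀ u → Unique (u ++ w) → x ∈ u → x ∈ w → ⊥
unique-disjoint (_ ∷ u) (al ∷ _) (here refl) q = All.lookup (Allₚ.++⁻ʳ u al) q refl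
unique-disjoint (_ ∷ u) (_ ∷ uq) (there p)   q = unique-disjoint u uq p q

unique-rows : ∀ (T : Tableau) → Unique (concat T) → All Unique T
unique-rows []      _ = []
unique-rows (r ∷ T) q = allPairs-++ˡ r q ∷ unique-rows T (allPairs-++ʳ r q)

sorted⇒strict : Sorted r → Unique r → Strict r
sorted⇒strict []      []       = []
sorted⇒strict (a ∷ s) (b ∷ q) = All.zipWith (λ (p , n) → ≤∧≢⇒< p n) (a , b) ∷ sorted⇒strict s q

ins-tableau : ∀ {w} → Unique w → IsTableau (ins w)
ins-tableau {w} uq = tableau (ne w []) strict (be w [])
  where
  ne : ∀ {T} w → All (_≢ []) T → All (_≢ []) (foldl _←_ T w)
  ne []      h = h
  ne (x ∷ w) h = ne w (←-nonempty x h)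
  be : ∀ {T} w → Linked Below T → Linked Below (foldl _←_ T w)
  be []      h = h
  be (x ∷ w) h = be w (insert-below x h)
  strict : All Strict (ins w)
  strict = All.zipWith (λ (p , q) → sorted⇒strict p q)
    (foldl-←-sorted w [] , unique-rows _ (Unique-resp-↭ (↭⇒↭ₛ (↭-sym (concat-ins-↭ w))) uq))

-- Words and their insertion tableaux

-- Each letter of s is passed with the help of the letter before it, whose value lies between the
-- two that are exchanged. The same holds for `slide-large`.
slide-small : Strict (y ∷ s) → x < y → y ∷ s ++ x ∷ w ~ y ∷ x ∷ s ++ w
slide-small {s = []}    _                  _   = rfl
slide-small {s = g ∷ s} ((y<g ∷ _) ∷ st) x<y = cons _ (slide-small st (<-trans x<y y<g)) ∙ symm (yxz x<y y<g)

slide-large : AllPairs _>_ (y ∷ s) → y < z → y ∷ s ++ z ∷ w ~ y ∷ z ∷ s ++ w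
slide-large {s = []}    _                y<z = rfl
slide-large {s = g ∷ s} ((g<y ∷ _) ∷ st) y<z = cons _ (slide-large st (<-trans g<y y<z)) ∙ yxz g<y y<z

bump-nothing : Bump x r r′ nothing → r′ ≡ r ++ [ x ]
bump-nothing end        = refl
bump-nothing (pass _ b) = cong (_ ∷_) (bump-nothing b)

-- First x moves left until it stands right behind the letter y that it bumps; then y moves left to
-- the front. Each letter h passed by y is followed by a letter between h and y, which permits the
-- move.
bump-~ : Strict r → All (x ≢_) r → Bump x r r′ (just y) → r ++ [ x ] ~ y ∷ r′
bump-~ st         _          (hit {r = r} x<y) =
  slide-small st x<y ∙ ~-reflexive (cong (λ r → _ ∷ _ ∷ r) (++-identityʳ r))
bump-~ {x = x} {y = y} (al ∷ st) (x≢h ∷ x≢) (pass {y = h} h≤x b) = cons _ (bump-~ st x≢ b) ∙ swapHead al b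
  where
  h<x = ≤∧≢⇒< h≤x (≢-sym x≢h)
  swapHead : ∀ {r r′} → All (h <_) r → Bump x r r′ (just y) → h ∷ y ∷ r′ ~ y ∷ h ∷ r′
  swapHead _         (hit x<y)  = xzy h<x x<y
  swapHead (h<g ∷ _) (pass p b) = xzy h<g (≤-<-trans p (bump-> b))

unique-resp-↭ : u ↭ w → Unique u → Unique w
unique-resp-↭ p = Unique-resp-↭ (↭⇒↭ₛ p)

unique-resp-~ : u ~ w → Unique u → Unique w
unique-resp-~ e = unique-resp-↭ (~⇒↭ e)

unique-snoc : ∀ r → Unique (r ++ [ x ]) → Unique r × All (x ≢_) r
unique-snoc []      _        = [] , []
unique-snoc (y ∷ r) (al ∷ q) with unique-snoc r q
... | q′ , al′ with Allₚ.++⁻ r al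
...   | al₁ , (p ∷ []) = al₁ ∷ q′ , ≢-sym p ∷ al′

reading-←-~ : ∀ {T} → All Sorted T → Unique (reading T ++ [ x ]) → reading T ++ [ x ] ~ reading (T ← x)
reading-←-~ {T = []}             _        _  = rfl
reading-←-~ {x} {T = r ∷ T} (s ∷ ss) uq rewrite ++-assoc (reading T) r [ x ]
  with unique-snoc r (allPairs-++ʳ (reading T) uq) | bump-total x r
... | _ | r′ , nothing , b rewrite ←-add {T = T} b | bump-nothing b = rfl
... | uq′ , x≢ | r′ , just y , b rewrite ←-bump {T = T} b =
  e ∙ ~-reflexive (sym (++-assoc (reading T) [ y ] r′))
    ∙ ~-++ʳ (reading-←-~ ss (allPairs-++ˡ (reading T ++ [ y ]) (subst Unique (sym (++-assoc (reading T) [ y ] r′)) (unique-resp-~ e uq))))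
  where
  e : reading T ++ r ++ [ x ] ~ reading T ++ y ∷ r′
  e = ~-++ˡ (reading T) (bump-~ (sorted⇒strict s uq′) x≢ b)

reading-foldl-~ : ∀ {T} w → All Sorted T → Unique (reading T ++ w) → reading T ++ w ~ reading (foldl _←_ T w)
reading-foldl-~ {T} []      _  _  = ~-reflexive (++-identityʳ (reading T))
reading-foldl-~ {T} (x ∷ w) ss uq =
  ~-reflexive (sym (++-assoc (reading T) [ x ] w)) ∙ ~-++ʳ e ∙
  reading-foldl-~ w (←-sorted x ss) (unique-resp-~ (~-++ʳ e) uq′)
  where
  uq′ : Unique ((reading T ++ [ x ]) ++ w)
  uq′ = subst Unique (sym (++-assoc (reading T) [ x ] w)) uq
  e : reading T ++ [ x ] ~ reading (T ← x)
  e = reading-←-~ ss (allPairs-++ˡ (reading T ++ [ x ]) uq′)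

~-reading-ins : Unique w → w ~ reading (ins w)
~-reading-ins {w} = reading-foldl-~ w []

-- Bounds on chains by the first row and by the number of rows

firstRow : Tableau → List ℕ
firstRow []      = []
firstRow (r ∷ _) = r

data Initial≤ : ℕ → ℕ → List ℕ → Set where
  []  : Initial≤ zero b r
  _∷_ : x ≤ b → Initial≤ i b r → Initial≤ (suc i) b (x ∷ r)

initial-skip : Initial≤ i b r → Bump x r r′ o → Initial≤ i b r′
initial-skip []      _          = []
initial-skip (p ∷ c) (hit q)    = ≤-trans (<⇒≤ q) p ∷ c
initial-skip (p ∷ c) (pass _ b) = p ∷ initial-skip c b

initial-take : Initial≤ i b r → b < x → Bump x r r′ o → Initial≤ (suc i) x r′
initial-take []      _   end          = ≤-refl ∷ []
initial-take []      _   (hit _)      = ≤-refl ∷ []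
initial-take []      b<x (pass p _)   = p ∷ []
initial-take (p ∷ c) b<x (hit x<y)    = ⊥-elim (<-asym x<y (≤-<-trans p b<x))
initial-take (_ ∷ c) b<x (pass p bmp) = p ∷ initial-take c b<x bmp

initial-length : Initial≤ i b r → i ≤ length r
initial-length []      = z≤n
initial-length (_ ∷ c) = s≤s (initial-length c)

firstRow-bump : ∀ T x → ∃ λ o → Bump x (firstRow T) (firstRow (T ← x)) o
firstRow-bump []      x = _ , end
firstRow-bump (r ∷ T) x with bump-total x r
... | r′ , nothing , b rewrite ←-add {T = T} b  = _ , b
... | r′ , just y  , b rewrite ←-bump {T = T} b = _ , b

-- A letter x > b inserted into a row with i initial entries at most b leaves i + 1 initial entries
-- at most x; any other insertion only lowers or appends entries. This gives the easy half of
-- Schensted's theorem on increasing subsequences.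
chain-initial : ∀ w T → Initial≤ i b (firstRow T) → Chain _<_ k b w →
                i + k ≤ length (firstRow (foldl _←_ T w))
chain-initial {i} {k = suc k} (x ∷ w) T c (p ∷ ch) rewrite +-suc i k =
  chain-initial w (T ← x) (initial-take c p (proj₂ (firstRow-bump T x))) ch
chain-initial (x ∷ w) T c (skip ch) = chain-initial w (T ← x) (initial-skip c (proj₂ (firstRow-bump T x))) ch
chain-initial []      T c []        = subst (_≤ _) (sym (+-identityʳ _)) (initial-length c)
chain-initial (x ∷ w) T c []        = chain-initial w (T ← x) (initial-skip c (proj₂ (firstRow-bump T x))) []

ascending-≤-firstRow : ∀ w → Has _<_ k w → k ≤ length (firstRow (ins w))
ascending-≤-firstRow w (_ , c) = chain-initial w [] [] c

chain-split : ∀ {R} u → Chain R k b (u ++ w) → ∃₂ λ i j → Chain R i b u × Has R j w × k ≡ i + j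
chain-split []      c        = _ , _ , [] , (_ , c) , refl
chain-split (x ∷ u) []       = _ , _ , [] , (0 , []) , refl
chain-split (x ∷ u) (p ∷ c)  = let _ , _ , d , e , eq = chain-split u c in _ , _ , p ∷ d , e , cong suc eq
chain-split (x ∷ u) (skip c) = let _ , _ , d , e , eq = chain-split u c in _ , _ , skip d , e , eq

strict-descending : Strict w → Chain _>_ k b w → k ≤ 1
strict-descending _         []         = z≤n
strict-descending (al ∷ _)  (_ ∷ c)    = s≤s (none al c)
  where
  none : All (x <_) w → Chain _>_ k x w → k ≤ 0
  none _        []       = z≤n
  none (p ∷ _)  (q ∷ _)  = ⊥-elim (<-asym p q)
  none (_ ∷ al) (skip c) = none al c
strict-descending (_ ∷ st)  (skip c)   = strict-descending st c

-- The reading word runs through each row from left to right, so a descending chain meets every row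
-- at most once.
descending-≤-rows : ∀ T → All Strict T → Has _>_ k (reading T) → k ≤ length T
descending-≤-rows []      _         (_ , []) = z≤n
descending-≤-rows (r ∷ T) (st ∷ ss) (_ , c)  with chain-split (reading T) c
... | i , j , d , (_ , e) , refl =
  ≤-trans (+-mono-≤ (descending-≤-rows T ss (_ , d)) (strict-descending st e)) (≤-reflexive (+-comm (length T) 1))

-- Patterns in permutations and in words

range : ℕ → List ℕ
range = applyUpTo suc

range-unique : ∀ n → Unique (range n)
range-unique n = Uniqueₚ.applyUpTo⁺₁ suc n (λ i<j _ eq → <⇒≢ i<j (suc-injective eq))

word-↭ : (π : Permutation′ n) → word π ↭ range n
word-↭ {n} π = ∼bag⇒↭ (unique∧set⇒bag
    (Uniqueₚ.tabulate⁺ (λ eq → FinPerm-injective (toℕ-injective (suc-injective eq))))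
    (range-unique n)
    (mk⇔ to from))
  where
  FinPerm-injective : ∀ {i j} → π ⟨$⟩ʳ i ≡ π ⟨$⟩ʳ j → i ≡ j
  FinPerm-injective eq = trans (sym (inverseˡ π)) (trans (cong (π ⟨$⟩ˡ_) eq) (inverseˡ π))
  to : x ∈ word π → x ∈ range n
  to p with ∈-tabulate⁻ p
  ... | i , refl = ∈-applyUpTo⁺ suc (toℕ<n (π ⟨$⟩ʳ i))
  from : x ∈ range n → x ∈ word π
  from p with ∈-applyUpTo⁻ suc p
  ... | i , i<n , refl = subst (_∈ word π)
    (cong suc (trans (cong toℕ (inverseʳ π)) (toℕ-fromℕ< i<n)))
    (∈-tabulate⁺ (π ⟨$⟩ˡ Fin.fromℕ< i<n))

permutationOf : w ↭ range n → ∃ λ (π : Permutation′ n) → word π ≡ w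
permutationOf {w} {n} p with trans (Permₚ.↭-length p) (length-applyUpTo suc n)
... | refl = onIndices (↭⇒↭ₛ p) ∘ₚ cast-id len , trans (tabulate-cong agrees) (tabulate-lookup w)
  where
  len : length (range (length w)) ≡ length w
  len = length-applyUpTo suc _
  agrees : ∀ i → suc (toℕ (Fin.cast len (onIndices (↭⇒↭ₛ p) ⟨$⟩ʳ i))) ≡ lookup w i
  agrees i = trans (cong suc (toℕ-cast len _))
    (trans (sym (lookup-applyUpTo suc (length w) _)) (sym (onIndices-lookup (↭⇒↭ₛ p) i)))

lower : (f : Fin k → Fin (suc m)) → (∀ i → zero {m} Fin.< f i) → ∃ λ (f′ : Fin k → Fin m) → ∀ i → f i ≡ suc (f′ i)
lower f f>0 = (λ i → proj₁ (peel (f i) (f>0 i))) , λ i → proj₂ (peel (f i) (f>0 i))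
  where
  peel : (j : Fin (suc m)) → zero {m} Fin.< j → ∃ λ j′ → j ≡ suc j′
  peel (suc j) _ = j , refl

tabulate-⊆ : (g : Fin m → ℕ) (f : Fin k → Fin m) → (∀ {i j} → i Fin.< j → f i Fin.< f j) →
             tabulate (g ∘ f) ⊆ tabulate g
tabulate-⊆ {k = zero}               g f mono = Sublist.minimum _
tabulate-⊆ {m = zero}  {k = suc k} g f mono with () ← f zero
tabulate-⊆ {m = suc m} {k = suc k} g f mono with f zero in eq
... | zero =
  let f′ , p = lower (f ∘ suc) (λ i → subst (Fin._< f (suc i)) eq (mono {zero} {suc i} z<s))
  in refl ∷ subst (_⊆ tabulate (g ∘ suc)) (tabulate-cong (λ i → cong g (sym (p i))))
       (tabulate-⊆ (g ∘ suc) f′ (λ {i} {j} i<j → s<s⁻¹ (subst₂ Fin._<_ (p i) (p j) (mono {suc i} {suc j} (s<s i<j)))))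
... | suc f₀ =
  let f′ , p = lower f positive
  in _ ∷ʳ subst (_⊆ tabulate (g ∘ suc))
       (trans (tabulate-cong (λ i → cong g (sym (p i)))) (cong₂ _∷_ (cong g eq) refl))
       (tabulate-⊆ (g ∘ suc) f′ (λ {i} {j} i<j → s<s⁻¹ (subst₂ Fin._<_ (p i) (p j) (mono i<j))))
  where
  positive : ∀ i → zero {m} Fin.< f i
  positive zero    = subst (zero {m} Fin.<_) (sym eq) z<s
  positive (suc i) = <-trans (positive zero) (mono {zero} {suc i} z<s)

⊆-tabulate : (h : Fin k → ℕ) (g : Fin m → ℕ) → tabulate h ⊆ tabulate g →
             ∃ λ (f : Fin k → Fin m) → (∀ {i j} → i Fin.< j → f i Fin.< f j) × (∀ i → h i ≡ g (f i))
⊆-tabulate {k = zero} h g s = (λ ()) , (λ { {()} }) , λ ()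
⊆-tabulate {k = suc k} {m = suc m} h g (eq ∷ s) =
  let f , mono , p = ⊆-tabulate (h ∘ suc) (g ∘ suc) s
  in (λ { zero → zero ; (suc i) → suc (f i) })
   , (λ { {zero} {suc j} _ → z<s ; {suc i} {suc j} i<j → s<s (mono (s<s⁻¹ i<j)) })
   , (λ { zero → eq ; (suc i) → p i })
⊆-tabulate {k = suc k} {m = suc m} h g (_ ∷ʳ s) =
  let f , mono , p = ⊆-tabulate h (g ∘ suc) s in suc ∘ f , (λ i<j → s<s (mono i<j)) , p

-- The relabelling that sends 0 to b and i to the i-th letter of the list. Past the end it goes on
-- in steps of one, so that it is strictly increasing on all of ℕ when b and the list are. Letters
-- of permutations start at 1, which leaves 0 free for b.
enumerate : ℕ → List ℕ → ℕ → ℕ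
enumerate b []       i       = b + i
enumerate b (x ∷ xs) zero    = b
enumerate b (x ∷ xs) (suc i) = enumerate x xs i

enumerate-0 : ∀ b xs → enumerate b xs 0 ≡ b
enumerate-0 b []      = +-identityʳ b
enumerate-0 b (_ ∷ _) = refl

enumerate-≥ : ∀ b xs i → Strict (b ∷ xs) → b ≤ enumerate b xs i
enumerate-≥ b []       i       _               = m≤m+n b i
enumerate-≥ b (x ∷ xs) zero    _               = ≤-refl
enumerate-≥ b (x ∷ xs) (suc i) ((p ∷ _) ∷ st) = ≤-trans (<⇒≤ p) (enumerate-≥ x xs i st)

enumerate-increasing : Strict (b ∷ xs) → StrictlyIncreasing (enumerate b xs)
enumerate-increasing {b} {[]}     _               i<j = +-monoʳ-< b i<j
enumerate-increasing {b} {x ∷ xs} ((p ∷ _) ∷ st) {zero}  {suc j} _   = <-≤-trans p (enumerate-≥ x xs j st)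
enumerate-increasing {b} {x ∷ xs} (_ ∷ st)       {suc i} {suc j} i<j = enumerate-increasing st (s<s⁻¹ i<j)

map-enumerate : ∀ b xs → map (enumerate b xs) (range (length xs)) ≡ xs
map-enumerate b xs = trans (map-applyUpTo suc (enumerate b xs) (length xs)) (go b xs)
  where
  go : ∀ b xs → applyUpTo (enumerate b xs ∘ suc) (length xs) ≡ xs
  go b []       = refl
  go b (x ∷ xs) = cong₂ _∷_ (enumerate-0 x xs) (go x xs)

enumerate-tabulate : ∀ b (h : Fin n → ℕ) i → enumerate b (tabulate h) (suc (toℕ i)) ≡ h i
enumerate-tabulate b h zero    = enumerate-0 (h zero) (tabulate (h ∘ suc))
enumerate-tabulate b h (suc i) = enumerate-tabulate (h zero) (h ∘ suc) i

-- Containment up to Knuth equivalence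

-- Some subsequence of s is order-isomorphic to a word Knuth equivalent to w.
record ContainsClass (s w : List ℕ) : Set where
  constructor contains
  field
    {relabel}   : ℕ → ℕ
    increasing  : StrictlyIncreasing relabel
    {subword}   : List ℕ
    subword⊆    : subword ⊆ s
    equivalent  : subword ~ map relabel w

Contains⇒ContainsClass : (σ : Permutation′ m) (π : Permutation′ k) → word π ~ w → Contains σ π → ContainsClass (word σ) w
Contains⇒ContainsClass {m} {k} σ π e (f , mono , iso) =
  contains ρ₀↗ (tabulate-⊆ (λ i → suc (toℕ (σ ⟨$⟩ʳ i))) f mono) (~-reflexive eq ∙ ~-map ρ₀↗ e)
  where
  -- The letter of the occurrence in σ that stands for the value v of π; it increases with v because
  -- the occurrence is order-isomorphic to π.
  h : Fin k → ℕ
  h v = suc (toℕ (σ ⟨$⟩ʳ f (π ⟨$⟩ˡ v)))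
  h↗ : ∀ {i j} → i Fin.< j → h i < h j
  h↗ {i} {j} i<j = s<s (Equivalence.to (iso _ _) (subst₂ Fin._<_ (sym (inverseʳ π)) (sym (inverseʳ π)) i<j))
  ρ₀ : ℕ → ℕ
  ρ₀ = enumerate 0 (tabulate h)
  ρ₀↗ : StrictlyIncreasing ρ₀
  ρ₀↗ = enumerate-increasing (Allₚ.tabulate⁺ (λ _ → z<s) ∷ AllPairsₚ.tabulate⁺-< h↗)
  eq : tabulate (λ i → suc (toℕ (σ ⟨$⟩ʳ f i))) ≡ map ρ₀ (word π)
  eq = sym (trans (map-tabulate _ ρ₀) (tabulate-cong (λ i →
    trans (enumerate-tabulate 0 h (π ⟨$⟩ʳ i)) (cong (λ j → suc (toℕ (σ ⟨$⟩ʳ f j))) (inverseˡ π)))))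

ContainsClass⇒Contains : (σ : Permutation′ m) → w ↭ range k → ContainsClass (word σ) w →
                         ∃ λ (π : Permutation′ k) → word π ~ w × Contains σ π
ContainsClass⇒Contains {w = w} {k} σ p (contains {ρ} ρ↗ s e) with proj₁ (~-unmap ρ↗ (symm e)) w refl
... | w′ , refl , e′ with permutationOf (↭-trans (~⇒↭ (symm e′)) p)
...   | π , refl with ⊆-tabulate _ _ (subst (_⊆ word σ) (map-tabulate _ ρ) s)
...     | f , mono , q = π , symm e′ , f , mono , λ i j → mk⇔
  (λ lt → s<s⁻¹ (subst₂ _<_ (q i) (q j) (ρ↗ (s<s lt))))
  (λ lt → s<s⁻¹ (increasing⇒reflects-< ρ↗ (subst₂ _<_ (sym (q i)) (sym (q j)) (s<s lt))))

-- Pattern-Knuth closedness speaks of avoidance, which is a negation. Only doubly negated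
-- containment can be drawn from it constructively, and that suffices to get avoidance back.
ClassClosed : List ℕ → Set
ClassClosed w = ∀ {n s t} → s ↭ range n → s ~ t → ContainsClass s w → ¬ ¬ ContainsClass t w

isTableau : (Q : SYT) → IsTableau (rows Q)
isTableau Q = tableau (rowsNonempty Q) (All.map (Linked⇒AllPairs <-trans) (rowsIncreasing Q)) (colsIncreasing Q)

reading-range : (Q : SYT) → reading (rows Q) ↭ range (length (concat (rows Q)))
reading-range Q = ↭-trans (reading-↭ (rows Q)) (entries Q)

word-unique : (π : Permutation′ n) → Unique (word π)
word-unique {n} π = unique-resp-↭ (↭-sym (word-↭ π)) (range-unique n)

K⇒~ : ∀ Q (π : Permutation′ n) → K Q n π → word π ~ reading (rows Q)
K⇒~ Q π eq = ~-reading-ins (word-unique π) ∙ ~-reflexive (cong reading eq)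

~⇒K : ∀ Q (π : Permutation′ n) → word π ~ reading (rows Q) → K Q n π
~⇒K Q π e = trans (ins-~ e) (ins-reading (isTableau Q))

insertionSYT : Permutation′ n → SYT
insertionSYT {n} σ = record
  { rows           = ins (word σ)
  ; rowsNonempty   = IsTableau.nonempty isT
  ; rowsIncreasing = All.map AllPairs⇒Linked (IsTableau.strict isT)
  ; colsIncreasing = IsTableau.below isT
  ; entries        = subst (λ m → concat (ins (word σ)) ↭ range m)
      (sym (trans (Permₚ.↭-length entries↭) (length-applyUpTo suc n))) entries↭
  }
  where
  isT : IsTableau (ins (word σ))
  isT = ins-tableau (word-unique σ)
  entries↭ : concat (ins (word σ)) ↭ range n
  entries↭ = ↭-trans (concat-ins-↭ (word σ)) (word-↭ σ)

closed⇒classClosed : ∀ P → PatternKnuthClosed (K P) → ClassClosed (reading (rows P))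
closed⇒classClosed P closed {n} p e s∋ ¬t∋ with permutationOf p | permutationOf (↭-trans (~⇒↭ (symm e)) p) | closed n
... | σ , refl | τ , refl | 𝒯 , 𝒯-classes
  with ContainsClass⇒Contains σ (reading-range P) s∋
... | π , e′ , σ∋π with Equivalence.to (𝒯-classes τ) (λ π′ k∈ τ∋ → ¬t∋ (Contains⇒ContainsClass τ π′ (K⇒~ P π′ k∈) τ∋))
...   | Q , Q∈ , τ∈ = Equivalence.from (𝒯-classes σ) (Q , Q∈ , trans (ins-~ e) τ∈) π (~⇒K P π e′) σ∋π

classClosed⇒closed : ∀ P → ClassClosed (reading (rows P)) → PatternKnuthClosed (K P)
classClosed⇒closed P closed n =
  -- The Knuth classes that meet the avoidance set; closedness shows that each of them lies inside
  -- it.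
  (λ Q → ∃ λ σ → 𝔖 n (K P) σ × K Q n σ) , λ σ → mk⇔
    (λ σ∈ → insertionSYT σ , (σ , σ∈ , refl) , refl)
    (λ { (Q , (τ , τ∈ , τ∈K) , σ∈K) π π∈ σ∋π →
      closed (word-↭ σ) (K⇒~ Q σ σ∈K ∙ symm (K⇒~ Q τ τ∈K))
        (Contains⇒ContainsClass σ π (K⇒~ P π π∈) σ∋π)
        (λ τ∋ → let π′ , e , τ∋π′ = ContainsClass⇒Contains τ (reading-range P) τ∋
                in τ∈ π′ (~⇒K P π′ e) τ∋π′) })

containsClass-reverse : ContainsClass s w → ContainsClass (reverse s) (reverse w)
containsClass-reverse {w = w} (contains {ρ} ρ↗ s e) =
  contains ρ↗ (reverse⁺ s) (~-reverse e ∙ ~-reflexive (sym (reverse-map ρ w)))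

classClosed-reverse : ClassClosed w → ClassClosed (reverse w)
classClosed-reverse {w} closed {s = s} {t} p e s∋ ¬t∋ =
  closed (↭-trans (Permₚ.↭-reverse s) p) (~-reverse e)
    (subst (ContainsClass _) (reverse-involutive w) (containsClass-reverse s∋))
    (λ t∋ → ¬t∋ (subst (λ t → ContainsClass t _) (reverse-involutive t) (containsClass-reverse t∋)))

-- Superstandard hooks

data Hook (R : Rel ℕ 0ℓ) (j k : ℕ) : List ℕ → Set where
  here  : Chain R j x w → Chain (flip R) k x w → Hook R j k (x ∷ w)
  there : Hook R j k w → Hook R j k (x ∷ w)

module _ {R : Rel ℕ 0ℓ} where

  hook-swap : Hook R j k w → Hook (flip R) k j w
  hook-swap (here c d) = here d c
  hook-swap (there h)  = there (hook-swap h)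

  hook-⊆ : u ⊆ w → Hook R j k u → Hook R j k w
  hook-⊆ (refl ∷ s) (here c d) = here (chain-⊆ s c) (chain-⊆ s d)
  hook-⊆ (refl ∷ s) (there h)  = there (hook-⊆ s h)
  hook-⊆ (_ ∷ʳ s)   h          = there (hook-⊆ s h)

  module _ (tr : Transitive R) (irr : ∀ {x} → ¬ R x x) where

    private
      asym : R a b → ¬ R b a
      asym p q = irr (tr p q)

    chain-tail : ¬ R b x → Chain R k b (x ∷ w) → Chain R k b w
    chain-tail ¬p []       = []
    chain-tail ¬p (p ∷ _)  = ⊥-elim (¬p p)
    chain-tail ¬p (skip c) = c

    -- Only x loses a letter behind it, namely z. An ascending chain from x through z cannot
    -- continue with y, so y can replace z; a descending chain from x does not use z.
    hook-xzy⇒zxy : R x y → R y z → Hook R j k (x ∷ z ∷ y ∷ w) → Hook R j k (z ∷ x ∷ y ∷ w)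
    hook-xzy⇒zxy {x} {y} {z} {w = w} x<y y<z (here c d) = there (here (ascend c) (descend d))
      where
      ascend : Chain R j x (z ∷ y ∷ w) → Chain R j x (y ∷ w)
      ascend []       = []
      ascend (_ ∷ c)  with chain-tail (asym y<z) c
      ... | c′ = x<y ∷ chain-weaken tr y<z c′
      ascend (skip c) = c
      descend : Chain (flip R) k x (z ∷ y ∷ w) → Chain (flip R) k x (y ∷ w)
      descend []       = []
      descend (p ∷ _)  = ⊥-elim (asym p (tr x<y y<z))
      descend (skip d) = d
    hook-xzy⇒zxy _ _ (there (here c d)) = here (skip c) (skip d)
    hook-xzy⇒zxy _ _ (there (there h))  = there (there h)

    -- If x is used with an ascending chain through z, then y takes its place.
    hook-yxz⇒yzx : R x y → R y z → Hook R j k (y ∷ x ∷ z ∷ w) → Hook R j k (y ∷ z ∷ x ∷ w)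
    hook-yxz⇒yzx {x} {y} {z} {w = w} x<y y<z (here c d) = here (ascend c) (descend d)
      where
      ascend : Chain R j y (x ∷ z ∷ w) → Chain R j y (z ∷ x ∷ w)
      ascend c with chain-tail (asym x<y) c
      ... | []      = []
      ... | p ∷ c′  = p ∷ skip c′
      ... | skip c′ = skip (skip c′)
      descend : Chain (flip R) k y (x ∷ z ∷ w) → Chain (flip R) k y (z ∷ x ∷ w)
      descend []              = []
      descend (p ∷ [])        = skip (p ∷ [])
      descend (p ∷ (q ∷ _))   = ⊥-elim (asym q (tr x<y y<z))
      descend (p ∷ skip d)    = skip (p ∷ d)
      descend (skip [])       = []
      descend (skip (p ∷ _))  = ⊥-elim (asym p y<z)
      descend (skip (skip d)) = skip (skip d)
    hook-yxz⇒yzx {x} {y} {z} {w = w} x<y y<z (there (here c d)) = replace c (descend d)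
      where
      descend : Chain (flip R) k x (z ∷ w) → Chain (flip R) k x w
      descend []       = []
      descend (p ∷ _)  = ⊥-elim (asym p (tr x<y y<z))
      descend (skip d) = d
      replace : Chain R j x (z ∷ w) → Chain (flip R) k x w → Hook R j k (y ∷ z ∷ x ∷ w)
      replace []       d = there (there (here [] d))
      replace (_ ∷ c)  d = here (y<z ∷ skip c) (chain-drop (λ p q → tr q p) (skip (x<y ∷ d)))
      replace (skip c) d = there (there (here c d))
    hook-yxz⇒yzx _ _ (there (there (here c d))) = there (here (skip c) (skip d))
    hook-yxz⇒yzx _ _ (there (there (there h)))  = there (there (there h))

-- The inverse of a move is the same move for the reversed order, which exchanges j and k.
hook-~ : u ~ w → (Hook _<_ j k u → Hook _<_ j k w) × (Hook _<_ j k w → Hook _<_ j k u)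
hook-~ (yxz p q) = hook-yxz⇒yzx <-trans <-irr p q ,
                   λ h → hook-swap (hook-yxz⇒yzx >-trans <-irr q p (hook-swap h))
hook-~ (xzy p q) = hook-xzy⇒zxy <-trans <-irr p q ,
                   λ h → hook-swap (hook-xzy⇒zxy >-trans <-irr q p (hook-swap h))
hook-~ (cons a e) =
    (λ { (here c d) → here (proj₁ (chain-<-~ e) c) (proj₁ (chain->-~ e) d) ; (there h) → there (proj₁ (hook-~ e) h) })
  , (λ { (here c d) → here (proj₂ (chain-<-~ e) c) (proj₂ (chain->-~ e) d) ; (there h) → there (proj₂ (hook-~ e) h) })
hook-~ rfl        = id , id
hook-~ (symm e)   = ×-swap (hook-~ e)
hook-~ (e ∙ f)    = proj₁ (hook-~ f) ∘ proj₁ (hook-~ e) , proj₂ (hook-~ e) ∘ proj₂ (hook-~ f)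

-- In use, b and b′ are the latest letters of the ascending and of the descending chain, and b′ ≤ h
-- ≤ b. The letter h is kept in front because the moves that separate the two chains need it as a
-- witness.
record Unshuffle (b b′ h j k : ℕ) (q : List ℕ) : Set where
  constructor unshuffle
  field
    {shuffled smaller larger} : List ℕ
    shuffled⊆ : shuffled ⊆ q
    sorts     : h ∷ shuffled ~ h ∷ smaller ++ larger
    decreases : AllPairs _>_ (b′ ∷ smaller)
    increases : Strict (b ∷ larger)
    smaller-length : length smaller ≡ k
    larger-length  : length larger ≡ j

extend : ∀ {R : Rel ℕ 0ℓ} → Transitive R → R a x → AllPairs R (x ∷ w) → AllPairs R (a ∷ x ∷ w)
extend tr p (al ∷ ps) = (p ∷ All.map (tr p) al) ∷ al ∷ ps

chain-uncons : ∀ {R : Rel ℕ 0ℓ} → Chain R k b (x ∷ w) → (∃ λ k′ → k ≡ suc k′ × R b x × Chain R k′ x w) ⊎ Chain R k b w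
chain-uncons []       = inj₂ []
chain-uncons (p ∷ c)  = inj₁ (_ , refl , p , c)
chain-uncons (skip c) = inj₂ c

unshuffle-chains : ∀ {b b′ h j k} q → b′ ≤ h → h ≤ b → Chain _<_ j b q → Chain _>_ k b′ q → Unshuffle b b′ h j k q
unshuffle-chains []      _ _ []  []  = unshuffle [] rfl ([] ∷ []) ([] ∷ []) refl refl
unshuffle-chains (z ∷ q) p p′ c d with chain-uncons c | chain-uncons d
... | inj₁ (_ , refl , b<z , c′) | inj₁ (_ , refl , z<b′ , _) =
  ⊥-elim (<-irrefl refl (<-≤-trans (<-trans b<z z<b′) (≤-trans p p′)))
... | inj₁ (_ , refl , b<z , c′) | inj₂ d′
  with unshuffle-chains q (≤-trans (≤-trans p p′) (<⇒≤ b<z)) ≤-refl c′ d′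
...   | unshuffle s e (al ∷ ds) as l l′ =
  -- The rest is sorted with z in front; then z slides right past the descending block, with h
  -- before that block as witness, and joins the ascending block.
  unshuffle (refl ∷ s) (cons _ e ∙ symm (slide-large (All.map (λ x<b′ → <-≤-trans x<b′ p) al ∷ ds) (≤-<-trans p′ b<z)))
    (al ∷ ds) (extend <-trans b<z as) l (cong suc l′)
unshuffle-chains (z ∷ q) p p′ c d | inj₂ c′ | inj₁ (_ , refl , z<b′ , d′)
  with unshuffle-chains q ≤-refl (<⇒≤ (<-≤-trans z<b′ (≤-trans p p′))) c′ d′
... | unshuffle s e ds as l l′ =
  unshuffle (refl ∷ s) (cons _ e) (extend >-trans z<b′ ds) as (cong suc l) l′
unshuffle-chains (z ∷ q) p p′ c d | inj₂ c′ | inj₂ d′ with unshuffle-chains q p p′ c′ d′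
... | unshuffle s e ds as l l′ = unshuffle (z ∷ʳ s) e ds as l l′

unshuffle-hook : Hook _<_ j k w → ∃ λ x → ∃₂ λ S L → ∃ λ u → x ∷ u ⊆ w × x ∷ u ~ x ∷ S ++ L ×
                 AllPairs _>_ (x ∷ S) × Strict (x ∷ L) × length S ≡ k × length L ≡ j
unshuffle-hook {w = x ∷ q} (here c d) with unshuffle-chains q (≤-refl {x}) ≤-refl c d
... | unshuffle s e ds as l l′ = x , _ , _ , _ , refl ∷ s , e , ds , as , l , l′
unshuffle-hook (there h) =
  let x , S , L , u , s , rest = unshuffle-hook h in x , S , L , u , _ ∷ʳ s , rest

reverse-All : ∀ {P : Pred ℕ 0ℓ} u → All P u → All P (reverse u)
reverse-All u al = Permₚ.All-resp-↭ (↭-sym (Permₚ.↭-reverse u)) al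

allPairs-reverse : ∀ {R : Rel ℕ 0ℓ} u → AllPairs R u → AllPairs (flip R) (reverse u)
allPairs-reverse []      _         = []
allPairs-reverse (x ∷ u) (al ∷ ps) rewrite unfold-reverse x u =
  AllPairsₚ.++⁺ (allPairs-reverse u ps) ([] ∷ []) (All.map (_∷ []) (reverse-All u al))

++-injective : ∀ u s → length u ≡ length s → u ++ w ≡ s ++ xs → u ≡ s × w ≡ xs
++-injective []      []      _   eq   = refl , eq
++-injective (x ∷ u) (y ∷ s) len eq with ∷-injective eq
... | refl , eq′ with ++-injective u s (suc-injective len) eq′
...   | refl , eq″ = refl , eq″

allPairs-chain : ∀ {R : Rel ℕ 0ℓ} → AllPairs R (x ∷ w) → Chain R (length w) x w
allPairs-chain {w = []}    _                  = []
allPairs-chain {w = _ ∷ _} ((p ∷ _) ∷ ps) = p ∷ allPairs-chain ps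

range-strict : ∀ n → Strict (range n)
range-strict n = AllPairsₚ.applyUpTo⁺₁ suc n (λ i<j _ → s<s i<j)

range-positive : s ↭ range n → All (0 <_) s
range-positive {n = n} p = Permₚ.All-resp-↭ (↭-sym p) (Allₚ.applyUpTo⁺₁ suc n (λ _ → z<s))

-- The first letter of the hook word is the bottom of the column: A ascends above it and the rest of
-- the column descends below it. Conversely, any letter with two such chains gives a copy, since the
-- column holds the smallest letters: enumerating the letters found in increasing order sends column
-- to column and row to row.
columnHook-classClosed : ∀ C A → x ∷ C ++ A ≡ range n → ClassClosed (reverse (x ∷ C) ++ A)
columnHook-classClosed {x} {n} C A eq {t = t} p e (contains {ρ₀} ρ₀↗ s⊆ e′) ¬t∋
  with unshuffle-hook {w = t} (proj₁ (hook-~ e) (hook-⊆ s⊆ (proj₂ (hook-~ e′) hook)))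
  where
  increasing : Strict (x ∷ C ++ A)
  increasing = subst Strict (sym eq) (range-strict n)
  decreasing : AllPairs _>_ (reverse (x ∷ C))
  decreasing = allPairs-reverse (x ∷ C) (allPairs-++ˡ (x ∷ C) increasing)
  below : ∀ u → AllPairs _<_ (u ++ A) → All (λ y → All (y <_) A) u
  below []      _         = []
  below (_ ∷ u) (al ∷ ps) = Allₚ.++⁻ʳ u al ∷ below u ps
  split : ∀ u {k} → length u ≡ suc k → AllPairs _>_ u → All (λ y → All (y <_) A) u → Hook _<_ (length A) k (u ++ A)
  split (y ∷ u) refl ds (al ∷ _) = here
    (chain-++ˡ u (allPairs-chain (al ∷ allPairs-++ʳ (x ∷ C) increasing)))
    (chain-++ʳ (allPairs-chain ds))
  hook₀ : Hook _<_ (length A) (length C) (reverse (x ∷ C) ++ A)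
  hook₀ = split (reverse (x ∷ C)) (length-reverse (x ∷ C)) decreasing
    (Permₚ.All-resp-↭ (↭-sym (Permₚ.↭-reverse (x ∷ C))) (below (x ∷ C) increasing))
  hook-map : ∀ {w} → Hook _<_ j k w → Hook _<_ j k (map ρ₀ w)
  hook-map (here c d) = here (chain-map ρ₀↗ c) (chain-map ρ₀↗ d)
  hook-map (there h)  = there (hook-map h)
  hook : Hook _<_ (length A) (length C) (map ρ₀ (reverse (x ∷ C) ++ A))
  hook = hook-map hook₀
... | y , S , L , u , u⊆ , e″ , ds , as , lS , lL =
  ¬t∋ (contains (enumerate-increasing strict₀) u⊆ (e″ ∙ ~-reflexive (sym word-eq)))
  where
  sorted : List ℕ
  sorted = reverse (y ∷ S) ++ L
  strict₁ : Strict sorted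
  strict₁ = AllPairsₚ.++⁺ (allPairs-reverse (y ∷ S) ds) (AllPairs.tail as)
    (Permₚ.All-resp-↭ (↭-sym (Permₚ.↭-reverse (y ∷ S)))
      (AllPairs.head as ∷ All.map (λ z<y → All.map (<-trans z<y) (AllPairs.head as)) (AllPairs.head ds)))
  positive : All (0 <_) sorted
  positive = Permₚ.All-resp-↭
    (↭-trans (~⇒↭ e″) (Permₚ.++⁺ʳ L (↭-sym (Permₚ.↭-reverse (y ∷ S)))))
    (All-resp-⊆ u⊆ (range-positive (↭-trans (~⇒↭ (symm e)) p)))
  strict₀ : Strict (0 ∷ sorted)
  strict₀ = positive ∷ strict₁
  f : ℕ → ℕ
  f = enumerate 0 sorted
  len : length (reverse (y ∷ S)) ≡ length (map f (x ∷ C))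
  len = trans (length-reverse (y ∷ S)) (trans (cong suc lS) (sym (length-map f (x ∷ C))))
  total : length sorted ≡ n
  total = trans (length-++ (reverse (y ∷ S)))
    (trans (cong₂ _+_ (trans (length-reverse (y ∷ S)) (cong suc lS)) lL)
      (trans (sym (length-++ (x ∷ C))) (trans (cong length eq) (length-applyUpTo suc n))))
  images : reverse (y ∷ S) ≡ map f (x ∷ C) × L ≡ map f A
  images = ++-injective _ _ len
    (trans (sym (map-enumerate 0 sorted))
      (trans (cong (map f) (trans (cong range total) (sym eq))) (map-++ f (x ∷ C) A)))
  word-eq : map f (reverse (x ∷ C) ++ A) ≡ y ∷ S ++ L
  word-eq = trans (map-++ f (reverse (x ∷ C)) A)
    (cong₂ _++_
      (trans (reverse-map f (x ∷ C))
        (trans (cong reverse (sym (proj₁ images))) (reverse-involutive (y ∷ S))))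
      (sym (proj₂ images)))

-- Other hooks

-- Makes room for a new letter suc t.
punch : ℕ → ℕ → ℕ
punch _       zero    = zero
punch zero    (suc y) = suc (suc y)
punch (suc t) (suc y) = suc (punch t y)

punch-low : y ≤ t → punch t y ≡ y
punch-low {zero}  _       = refl
punch-low {suc y} (s≤s p) = cong suc (punch-low p)

punch-high : t < y → punch t y ≡ suc y
punch-high {zero}  {suc y} _       = refl
punch-high {suc t} {suc y} (s≤s p) = cong suc (punch-high p)

punch-increasing : ∀ t → StrictlyIncreasing (punch t)
punch-increasing zero    {zero}  {suc y} _       = z<s
punch-increasing zero    {suc x} {suc y} (s≤s p) = s<s (s<s p)
punch-increasing (suc t) {zero}  {suc y} _       = z<s
punch-increasing (suc t) {suc x} {suc y} (s≤s p) = s<s (punch-increasing t p)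

punch-range : t ≤ n → suc t ∷ map (punch t) (range n) ↭ range (suc n)
punch-range {zero}  {n}     _       = ↭-reflexive (cong (1 ∷_) (map-applyUpTo suc (punch 0) n))
punch-range {suc t} {suc n} (s≤s p) = ↭-trans (swap (suc (suc t)) 1 ↭-refl) (prep 1
  (↭-trans (↭-reflexive (cong (suc (suc t) ∷_) shift))
    (↭-trans (Permₚ.map⁺ suc (punch-range p)) (↭-reflexive (map-applyUpTo suc suc (suc n))))))
  where
  shift : map (punch (suc t)) (applyUpTo (λ i → suc (suc i)) n) ≡ map suc (map (punch t) (range n))
  shift = trans (cong (map (punch (suc t))) (sym (map-applyUpTo suc suc n)))
    (trans (sym (map-∘ {g = punch (suc t)} {f = suc} (range n))) (map-∘ {g = suc} {f = punch t} (range n)))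

punch-↭ : t ≤ n → w ↭ range n → suc t ∷ map (punch t) w ↭ range (suc n)
punch-↭ t≤n p = ↭-trans (prep _ (Permₚ.map⁺ _ p)) (punch-range t≤n)

slide-smallest : AllPairs _>_ s → All (y <_) s → x < y → s ++ x ∷ y ∷ w ~ x ∷ s ++ y ∷ w
slide-smallest []                    _           _   = rfl
slide-smallest {s = e ∷ []}    _     (y<e ∷ _)   x<y = symm (xzy x<y y<e)
slide-smallest {s = e ∷ h ∷ s} ((h<e ∷ _) ∷ ds) (_ ∷ al@(y<h ∷ _)) x<y =
  cons e (slide-smallest ds al x<y) ∙ symm (xzy (<-trans x<y y<h) h<e)

data StartsAt (x k : ℕ) : List ℕ → Set where
  here  : Chain _>_ k x w → StartsAt x k (x ∷ w)
  there : StartsAt x k w → StartsAt x k (y ∷ w)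

chain-startsAt : Chain _>_ (suc k) (suc x) w → Chain _>_ (suc k) x w ⊎ StartsAt x k w
chain-startsAt (p ∷ c) with m≤n⇒m<n∨m≡n (s≤s⁻¹ p)
... | inj₁ q    = inj₁ (q ∷ c)
... | inj₂ refl = inj₂ (here c)
chain-startsAt (skip c) with chain-startsAt c
... | inj₁ d = inj₁ (skip d)
... | inj₂ s = inj₂ (there s)

startsAt-chain : StartsAt x k w → Chain _>_ k x w
startsAt-chain (here c)  = skip c
startsAt-chain (there s) = skip (startsAt-chain s)

startsAt-tail : StartsAt x k (y ∷ w) → Chain _>_ k x w
startsAt-tail (here c)  = c
startsAt-tail (there s) = startsAt-chain s

startsAt-⊆ : u ⊆ w → StartsAt x k u → StartsAt x k w
startsAt-⊆ (refl ∷ s) (here c)  = here (chain-⊆ s c)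
startsAt-⊆ (refl ∷ s) (there h) = there (startsAt-⊆ s h)
startsAt-⊆ (_ ∷ʳ s)   h         = there (startsAt-⊆ s h)

startsAt-++⁻ : ∀ u → All (x ≢_) u → StartsAt x k (u ++ w) → StartsAt x k w
startsAt-++⁻ []      _        s         = s
startsAt-++⁻ (_ ∷ u) (p ∷ _)  (here _)  = ⊥-elim (p refl)
startsAt-++⁻ (_ ∷ u) (_ ∷ al) (there s) = startsAt-++⁻ u al s

chain-dropPrefix : ∀ {R : Rel ℕ 0ℓ} u → All (λ y → ¬ R b y) u → Chain R k b (u ++ w) → Chain R k b w
chain-dropPrefix []      _        c        = c
chain-dropPrefix (_ ∷ u) _        []       = []
chain-dropPrefix (_ ∷ u) (p ∷ _)  (q ∷ _)  = ⊥-elim (p q)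
chain-dropPrefix (_ ∷ u) (_ ∷ al) (skip c) = chain-dropPrefix u al c

chain-length : ∀ {R : Rel ℕ 0ℓ} → Chain R k b w → k ≤ length w
chain-length []       = z≤n
chain-length (_ ∷ c)  = s≤s (chain-length c)
chain-length (skip c) = m≤n⇒m≤1+n (chain-length c)

increasing-inflates : StrictlyIncreasing ρ → ∀ x → x ≤ ρ x
increasing-inflates ρ↗ zero    = z≤n
increasing-inflates ρ↗ (suc x) = ≤-<-trans (increasing-inflates ρ↗ x) (ρ↗ ≤-refl)

increasing-gap : StrictlyIncreasing ρ → ∀ d x → d + ρ x ≤ ρ (d + x)
increasing-gap ρ↗ zero    x = ≤-refl
increasing-gap ρ↗ (suc d) x = ≤-<-trans (increasing-gap ρ↗ d x) (ρ↗ ≤-refl)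

reverse-mid : ∀ (u : List ℕ) y w → reverse (u ++ y ∷ w) ≡ reverse w ++ y ∷ reverse u
reverse-mid u y w = trans (reverse-++ u (y ∷ w))
  (trans (cong (_++ reverse u) (unfold-reverse y w)) (++-assoc (reverse w) [ y ] (reverse u)))

strict-map : StrictlyIncreasing ρ → Strict w → Strict (map ρ w)
strict-map ρ↗ st = AllPairsₚ.map⁺ (AllPairs.map ρ↗ st)

last∈range : 0 < n → n ∈ range n
last∈range {suc n} _ = ∈-applyUpTo⁺ suc ≤-refl

-- In a hook word, let the row letter suc t precede the column letter m = t + 2, with
-- column letters C₁ below it. Every subsequence Knuth equivalent to (a copy of) the hook word
-- has a descending chain through C₁ from the copy of m, but not from a smaller letter. Such
-- a chain is absent once m has been slid past C₁.
module _ {n t x a C₁ C₂ A}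
  (C₁≢[] : 1 ≤ length C₁) (C₁≤t : All (_≤ t) C₁) (a<m : a < suc (suc t))
  (column : Strict (x ∷ C₁ ++ suc (suc t) ∷ C₂)) (row : Strict (x ∷ a ∷ A))
  (hook-↭ : reverse (C₁ ++ suc (suc t) ∷ C₂) ++ x ∷ a ∷ A ↭ range n) where

  private
    μ : ℕ
    μ = suc (suc t)

    hook : List ℕ
    hook = reverse (C₁ ++ μ ∷ C₂) ++ x ∷ a ∷ A

    f : ℕ → ℕ
    f = punch t
    f↗ : StrictlyIncreasing f
    f↗ = punch-increasing t

    D E : List ℕ
    D = reverse (map f C₁)
    E = reverse (map f C₂)

    fm≡ : f μ ≡ suc μ
    fm≡ = punch-high {t} (s<s (n≤1+n t))

    column′ : Strict (C₁ ++ μ ∷ C₂)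
    column′ = AllPairs.tail column

    m<C₂ : All (μ <_) C₂
    m<C₂ = AllPairs.head (allPairs-++ʳ C₁ column′)

    x≤t : x ≤ t
    x≤t = go C₁ C₁≢[] C₁≤t (AllPairs.head column)
      where
      go : ∀ C → 1 ≤ length C → All (_≤ t) C → All (x <_) (C ++ μ ∷ C₂) → x ≤ t
      go (_ ∷ _) _ (p ∷ _) (q ∷ _) = ≤-trans (<⇒≤ q) p

    hook-split : hook ≡ reverse C₂ ++ μ ∷ reverse C₁ ++ x ∷ a ∷ A
    hook-split = trans (cong (_++ x ∷ a ∷ A) (reverse-mid C₁ μ C₂)) (++-assoc (reverse C₂) (μ ∷ reverse C₁) (x ∷ a ∷ A))

    -- The new letter `suc t` stands in front, and its value is just below that of the raised row
    -- letter f (t + 1) = μ.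
    σ τ : List ℕ
    σ = suc t ∷ map f hook
    τ = E ++ suc t ∷ D ++ f x ∷ suc μ ∷ map f (a ∷ A)

    map-hook : map f hook ≡ E ++ suc μ ∷ D ++ f x ∷ map f (a ∷ A)
    map-hook = trans (cong (map f) hook-split)
      (trans (map-++ f (reverse C₂) _)
        (cong₂ _++_ (reverse-map f C₂)
          (cong₂ _∷_ fm≡ (trans (map-++ f (reverse C₁) _) (cong (_++ f x ∷ map f (a ∷ A)) (reverse-map f C₁))))))

    D-low : All (_≤ t) D
    D-low = reverse-All (map f C₁) (Allₚ.map⁺ (All.map (λ p → ≤-trans (≤-reflexive (punch-low p)) p) C₁≤t))

    E-high : All (suc μ <_) E
    E-high = reverse-All (map f C₂) (Allₚ.map⁺ (All.map (λ {y} p → subst (_< f y) fm≡ (f↗ p)) m<C₂))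

    decreasing-image : ∀ u → Strict u → AllPairs _>_ (reverse (map f u))
    decreasing-image u st = allPairs-reverse (map f u) (strict-map f↗ st)

    -- The new letter passes E because the smaller f μ follows E. It is then the witness for moving
    -- f μ behind D, and f a is the witness for moving f μ behind f x.
    σ~τ : σ ~ τ
    σ~τ = ~-reflexive (cong (suc t ∷_) map-hook)
      ∙ symm (slide-smallest (decreasing-image C₂ (AllPairs.tail (allPairs-++ʳ C₁ column′)))
               E-high (s≤s (n≤1+n (suc t))))
      ∙ ~-++ˡ E (symm (slide-large (All.map s≤s D-low ∷ decreasing-image C₁ (allPairs-++ˡ C₁ column′)) (s≤s (n≤1+n (suc t))))
                ∙ cons (suc t) (~-++ˡ D (symm (xzy (f↗ (All.head (AllPairs.head row))) (subst (f a <_) fm≡ (f↗ a<m))))))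

    -- The chain consists of the copies of μ, of C₁ from the bottom up, and of x. The bound is one
    -- more than the copy of μ so that the chain may begin with that letter.
    hook-starts : StrictlyIncreasing ρ → Chain _>_ (2 + length C₁) (suc (ρ μ)) (map ρ hook)
    hook-starts {ρ = r} r↗ = subst (Chain _>_ _ _) (sym eq) (chain-++ˡ (map r (reverse C₂)) (≤-refl ∷ chain-map r↗ chain))
      where
      eq : map r hook ≡ map r (reverse C₂) ++ r μ ∷ map r (reverse C₁ ++ x ∷ a ∷ A)
      eq = trans (cong (map r) hook-split) (map-++ r (reverse C₂) _)
      ds : AllPairs _>_ (μ ∷ reverse C₁ ++ [ x ])
      ds = allPairs-++ʳ (reverse C₂) (subst (AllPairs _>_)
        (trans (reverse-mid (x ∷ C₁) μ C₂) (cong (λ u → reverse C₂ ++ μ ∷ u) (unfold-reverse x C₁)))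
        (allPairs-reverse (x ∷ C₁ ++ μ ∷ C₂) column))
      chain : Chain _>_ (suc (length C₁)) μ (reverse C₁ ++ x ∷ a ∷ A)
      chain = subst₂ (λ k w → Chain _>_ k μ w)
        (trans (length-++ (reverse C₁)) (trans (+-comm _ 1) (cong suc (length-reverse C₁))))
        (++-assoc (reverse C₁) [ x ] (a ∷ A))
        (chain-++ʳ (allPairs-chain ds))

    -- The letters smaller than μ are found in C₁, all of them usable, and in the row, which
    -- contributes at most one.
    hook-not-earlier : ¬ Chain _>_ (2 + length C₁) μ hook
    hook-not-earlier c with chain-split (reverse C₁) (chain-tail >-trans <-irr <-irr
      (chain-dropPrefix (reverse C₂) (reverse-All C₂ (All.map <⇒≯ m<C₂)) (subst (Chain _>_ _ _) hook-split c)))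
    ... | i , j , d , (_ , e) , eq = <-irr (≤-trans (≤-reflexive eq)
      (≤-trans (+-mono-≤ (≤-trans (chain-length d) (≤-reflexive (length-reverse C₁))) (strict-descending row e))
        (≤-reflexive (+-comm (length C₁) 1))))

    m∈hook : μ ∈ hook
    m∈hook = subst (μ ∈_) (sym hook-split) (∈-++⁺ʳ (reverse C₂) (here refl))

    m≤n : μ ≤ n
    m≤n with ∈-applyUpTo⁻ suc (∈-resp-↭ hook-↭ m∈hook)
    ... | _ , i<n , refl = i<n

    σ-↭ : σ ↭ range (suc n)
    σ-↭ = punch-↭ (≤-trans (m≤n+m t 2) m≤n) hook-↭

    range-bounded : ∀ {k w} → w ↭ range k → All (_≤ k) w
    range-bounded {k} p = Permₚ.All-resp-↭ (↭-sym p) (Allₚ.applyUpTo⁺₁ suc k id)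

    τ-avoids : ¬ ContainsClass τ hook
    τ-avoids (contains {ρ₀} ρ₀↗ {u} u⊆ e) with chain-startsAt (proj₂ (chain->-~ e) (hook-starts ρ₀↗))
    ... | inj₁ c = hook-not-earlier (chain-unmap (increasing⇒reflects-< ρ₀↗) (proj₁ (chain->-~ e) c))
    ... | inj₂ s = <-irr (≤-trans (s≤s C₁≢[]) (strict-descending (strict-map f↗ (AllPairs.tail row)) (startsAt-tail located)))
      where
      -- A copy of n letters within n + 1 letters raises each letter by at most one, so the copy of
      -- μ is μ or μ + 1.
      ρn≤ : ρ₀ n ≤ suc n
      ρn≤ = All.lookup (All-resp-⊆ u⊆ (range-bounded (↭-trans (~⇒↭ (symm σ~τ)) σ-↭)))
        (∈-resp-↭ (↭-sym (~⇒↭ e)) (∈-map⁺ ρ₀ (∈-resp-↭ (↭-sym hook-↭) (last∈range (≤-trans z<s m≤n)))))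
      ρm≤ : ρ₀ μ ≤ suc μ
      ρm≤ = +-cancelˡ-≤ (n ∸ μ) _ _ (≤-trans (increasing-gap ρ₀↗ (n ∸ μ) μ)
        (≤-trans (≤-reflexive (cong ρ₀ (m∸n+n≡m m≤n)))
          (≤-trans ρn≤ (≤-reflexive (trans (cong suc (sym (m∸n+n≡m m≤n))) (sym (+-suc (n ∸ μ) μ)))))))
      m≤ρm : μ ≤ ρ₀ μ
      m≤ρm = increasing-inflates ρ₀↗ μ
      low≢ : ∀ {y} → y ≤ suc t → ρ₀ μ ≢ y
      low≢ p = >⇒≢ (<-≤-trans (s≤s p) m≤ρm)
      -- In front of `suc μ`, the letters of E exceed μ + 1 and all others are below μ. Behind it
      -- there is only an increasing row, too poor for the descent.
      located : StartsAt (ρ₀ μ) (suc (length C₁)) (suc μ ∷ map f (a ∷ A))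
      located = startsAt-++⁻ [ f x ] (low≢ (≤-trans (≤-reflexive (punch-low x≤t)) (m≤n⇒m≤1+n x≤t)) ∷ [])
        (startsAt-++⁻ D (All.map (λ p → low≢ (m≤n⇒m≤1+n p)) D-low)
          (startsAt-++⁻ [ suc t ] (low≢ ≤-refl ∷ [])
            (startsAt-++⁻ E (All.map (λ p → <⇒≢ (≤-<-trans ρm≤ p)) E-high) (startsAt-⊆ u⊆ s))))

  hook-not-classClosed : ¬ ClassClosed hook
  hook-not-classClosed closed = closed σ-↭ σ~τ (contains f↗ (suc t ∷ʳ ⊆-refl) rfl) τ-avoids

-- Shapes that are not hooks

reading-All : ∀ {P : Pred ℕ 0ℓ} → All (All P) T → All P (reading T)
reading-All []         = []
reading-All (ps ∷ pss) = Allₚ.++⁺ (reading-All pss) ps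

tableau-corner : IsTableau ((a ∷ r) ∷ T) → All (All (a <_)) T
tableau-corner {T = []}      _ = []
tableau-corner {T = [] ∷ T}  (tableau (_ ∷ ne ∷ _) _ _) = ⊥-elim (ne refl)
tableau-corner {T = (c ∷ cs) ∷ T} t@(tableau _ (_ ∷ (c<cs ∷ _) ∷ _) ((a<c ∷ _) ∷ _)) =
  (a<c ∷ All.map (<-trans a<c) c<cs) ∷ All.map (All.map (<-trans a<c)) (tableau-corner (tableau-tail t))

chain->-raise : a ≤ b → Chain _>_ k a w → Chain _>_ k b w
chain->-raise p []       = []
chain->-raise p (q ∷ c)  = <-≤-trans q p ∷ c
chain->-raise p (skip c) = skip (chain->-raise p c)

⊆-insert : ∀ u → u ++ w ⊆ u ++ y ∷ w
⊆-insert []      = _ ∷ʳ ⊆-refl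
⊆-insert (_ ∷ u) = refl ∷ ⊆-insert u

map-reading-++ : ∀ (ρ : ℕ → ℕ) r T {q} → map ρ (reading (r ∷ T)) ++ q ≡ map ρ (reading T) ++ map ρ r ++ q
map-reading-++ ρ r T {q} = trans (cong (_++ q) (map-++ ρ (reading T) r)) (++-assoc (map ρ (reading T)) (map ρ r) q)

-- Relabelling and continuation are arbitrary because the chain is needed in words whose letters
-- have been raised to make room for a new one.
firstColumn-descends : ∀ {ρ k b q} T → StrictlyIncreasing ρ → IsTableau T → All (All (λ y → b ≤ ρ y)) T →
                       Chain _>_ k b q → Has _>_ (length T + k) (map ρ (reading T) ++ q)
firstColumn-descends [] _ _ _ c = _ , c
firstColumn-descends ([] ∷ T) _ (tableau (ne ∷ _) _ _) _ _ = ⊥-elim (ne refl)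
firstColumn-descends {ρ} {k} {q = q} ((h ∷ r) ∷ T) ρ↗ isT ((b≤h ∷ _) ∷ _) c =
  subst₂ (Has _>_) (+-suc (length T) k) (sym (map-reading-++ ρ (h ∷ r) T))
    (firstColumn-descends T ρ↗ (tableau-tail isT) (All.map (All.map ρ↗) (tableau-corner isT))
      (≤-refl ∷ chain-++ˡ (map ρ r) (chain->-raise b≤h c)))

-- Either the row above cs may lose its first letter, or an ascending chain as long as that row
-- starts in cs.
rowScan : ∀ {b} cs as → Strict (b ∷ cs) → Strict as → Prefix _>_ cs as → All (λ c → All (c ≢_) as) cs →
          Prefix _>_ cs (drop 1 as) ⊎ Chain _<_ (length as) b (cs ++ as)
rowScan [] as _ _ _ _ = inj₁ []
rowScan (c ∷ cs) (a ∷ []) ((b<c ∷ _) ∷ _) _ _ _ = inj₂ (b<c ∷ [])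
rowScan (c ∷ cs) (a ∷ a′ ∷ as) ((b<c ∷ _) ∷ st) (_ ∷ st′) (_ ∷ pre) ((_ ∷ c≢a′ ∷ _) ∷ ≢s) with <-cmp c a′
... | tri< c<a′ _ _ = inj₂ (b<c ∷ chain-++ˡ cs (skip (c<a′ ∷ allPairs-chain st′)))
... | tri≈ _ c≡a′ _ = ⊥-elim (c≢a′ c≡a′)
... | tri> _ _ a′<c with rowScan cs (a′ ∷ as) st st′ pre (All.map All.tail ≢s)
...   | inj₁ pre′ = inj₁ (a′<c ∷ pre′)
...   | inj₂ ch   = inj₂ (b<c ∷ chain-⊆ (⊆-insert cs) ch)

-- T′ is T with its first column moved up by one, the corner being lost.
data ColumnShift : Tableau → Tableau → Set where
  last : ColumnShift ([ α ] ∷ []) []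
  more : All (α′ <_) r → ColumnShift ((α′ ∷ s) ∷ T) T′ → ColumnShift ((α ∷ r) ∷ (α′ ∷ s) ∷ T) ((α′ ∷ r) ∷ T′)

-- The lost corner bumps the head of each row into the next row, which moves the first column down
-- again.
columnShift-← : ColumnShift ((α ∷ r) ∷ T) T′ → Linked Below ((α ∷ r) ∷ T) → T′ ← α ≡ (α ∷ r) ∷ T
columnShift-← last          _                    = refl
columnShift-← (more {T′ = T′} _ sh) ((α<α′ ∷ _) ∷ be) =
  trans (←-bump {T = T′} (hit α<α′)) (cong (_ ∷_) (columnShift-← sh be))

columnShift-tableau : ColumnShift T T′ → IsTableau T → IsTableau T′
columnShift-tableau last _ = tableau [] [] []
columnShift-tableau (more α′<r sh) isT@(tableau _ ((_ ∷ st) ∷ _) (pre ∷ _))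
  with columnShift-tableau sh (tableau-tail isT) | sh
... | _ | last = tableau ((λ ()) ∷ []) ((α′<r ∷ st) ∷ []) [-]
... | tableau ne ss be | more _ _ with pre | IsTableau.below isT
...   | _ ∷ pre′ | _ ∷ (α′<α″ ∷ _) ∷ _ = tableau ((λ ()) ∷ ne) ((α′<r ∷ st) ∷ ss) ((α′<α″ ∷ pre′) ∷ be)

columnShift-length : ColumnShift T T′ → length T ≡ suc (length T′)
columnShift-length last        = refl
columnShift-length (more _ sh) = cong suc (columnShift-length sh)

singles-shift : ∀ {α} T → IsTableau ([ α ] ∷ T) → ∃ (ColumnShift ([ α ] ∷ T))
singles-shift []                 _ = _ , last
singles-shift ([] ∷ T)           (tableau (_ ∷ ne ∷ _) _ _) = ⊥-elim (ne refl)
singles-shift ((_ ∷ []) ∷ T)    isT = let _ , sh = singles-shift T (tableau-tail isT) in _ , more [] sh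
singles-shift ((_ ∷ _ ∷ _) ∷ T) (tableau _ _ ((_ ∷ ()) ∷ _))

-- Here α and β are the first two letters of the row above T. The chain takes one letter from each
-- row of T, skips α, takes β, and continues in q, where the new letter will stand.
ShortcutDescent : ℕ → ℕ → Tableau → Set
ShortcutDescent α β T = ∀ {ρ k q} → StrictlyIncreasing ρ → Chain _>_ k (ρ β) q →
  Has _>_ (suc (length T + k)) (map ρ (reading T) ++ ρ α ∷ ρ β ∷ q)

-- Either the first column can be moved up, or a descending chain of the rows from T upwards
-- starts in the first column, changes to the second one, and ends in β.
columnScan : ∀ {α β r} T → IsTableau ((α ∷ β ∷ r) ∷ T) → Unique (reading ((α ∷ β ∷ r) ∷ T)) →
             ShortcutDescent α β T ⊎ ∃ (ColumnShift ((α ∷ β ∷ r) ∷ T))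
columnScan [] _ _ = inj₁ λ _ c → _ , skip (≤-refl ∷ c)
columnScan ([] ∷ T) (tableau (_ ∷ ne ∷ _) _ _) _ = ⊥-elim (ne refl)
columnScan {α} {β} {r} ((α′ ∷ s) ∷ T) isT uq with <-cmp α′ β
... | tri≈ _ refl _ = ⊥-elim (unique-disjoint (reading ((α′ ∷ s) ∷ T)) uq
        (∈-++⁺ʳ (reading T) (here refl)) (there (here refl)))
... | tri> _ _ β<α′ = inj₁ λ {ρ} {k} {q} ρ↗ c → subst (λ n → Has _>_ n (map ρ (reading ((α′ ∷ s) ∷ T)) ++ ρ α ∷ ρ β ∷ q)) (+-suc (suc (length T)) k)
        (firstColumn-descends ((α′ ∷ s) ∷ T) ρ↗ (tableau-tail isT)
          (All.map (All.map ρ↗) (beyond (tableau-tail isT)))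
          (skip (≤-refl ∷ c)))
  where
  beyond : IsTableau ((α′ ∷ s) ∷ T) → All (All (β <_)) ((α′ ∷ s) ∷ T)
  beyond isT′@(tableau _ ((α′<s ∷ _) ∷ _) _) =
    (β<α′ ∷ All.map (<-trans β<α′) α′<s) ∷ All.map (All.map (<-trans β<α′)) (tableau-corner isT′)
columnScan {α} {β} {r} ((α′ ∷ []) ∷ T) isT@(tableau _ ((_ ∷ β<r ∷ _) ∷ _) _) uq | tri< α′<β _ _ =
  let _ , sh = singles-shift T (tableau-tail isT)
  in inj₂ (_ , more (α′<β ∷ All.map (<-trans α′<β) β<r) sh)
columnScan {α} {β} {r} ((α′ ∷ β′ ∷ s) ∷ T) isT@(tableau _ ((_ ∷ β<r ∷ _) ∷ _) ((_ ∷ β<β′ ∷ _) ∷ _)) uq | tri< α′<β _ _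
  with columnScan T (tableau-tail isT) (allPairs-++ˡ (reading ((α′ ∷ β′ ∷ s) ∷ T)) uq)
... | inj₂ (_ , sh) = inj₂ (_ , more (α′<β ∷ All.map (<-trans α′<β) β<r) sh)
... | inj₁ F = inj₁ λ {ρ} {k} {q} ρ↗ c →
  subst₂ (Has _>_) (cong suc (+-suc (length T) k)) (sym (map-reading-++ ρ (α′ ∷ β′ ∷ s) T))
    (F ρ↗ (chain-++ˡ (map ρ s) (skip (ρ↗ β<β′ ∷ c))))

-- One new letter that lengthens both kinds of chains

spread : ℕ → List ℕ → List ℕ → List ℕ
spread t w₁ w₂ = map (punch t) w₁ ++ suc t ∷ map (punch t) w₂

-- A word of the class of T in which one new letter suc t lengthens both the longest ascending and
-- the longest descending chains.
record Crossing (T : Tableau) : Set where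
  constructor crossing
  field
    {before after} : List ℕ
    {threshold}    : ℕ
    equivalent     : before ++ after ~ reading T
    threshold∈     : threshold ∈ reading T
    ascends        : Has _<_ (suc (length (firstRow T))) (spread threshold before after)
    descends       : Has _>_ (suc (length T)) (spread threshold before after)

-- A minimal letter that comes first stays at the head of the first row, and every later letter
-- passes it.
ins-prependMin : All (m ≤_) w → ins w ≡ r ∷ T → ins (m ∷ w) ≡ (m ∷ r) ∷ T
ins-prependMin {w = x ∷ w} al eq with rowInsert-total [] (x ∷ w)
... | r′ , w′ , i with ∷-injective (trans (sym (foldl-←-row {T = []} i)) eq)
...   | refl , refl = foldl-←-row {T = []} (rowInsert-pass al i)

chain-snoc : ∀ {R : Rel ℕ 0ℓ} → All (λ y → R y x) w → R b x → Chain R k b w → Chain R (suc k) b (w ++ [ x ])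
chain-snoc {w = w}     _        p []       = chain-++ˡ w (p ∷ [])
chain-snoc             (q ∷ al) p (r ∷ c)  = r ∷ chain-snoc al q c
chain-snoc             (_ ∷ al) p (skip c) = skip (chain-snoc al p c)

spread-All : ∀ {P : Pred ℕ 0ℓ} w₁ w₂ → All (P ∘ punch t) (w₁ ++ w₂) → P (suc t) → All P (spread t w₁ w₂)
spread-All w₁ w₂ al p = Allₚ.++⁺ (Allₚ.map⁺ (Allₚ.++⁻ˡ w₁ al)) (p ∷ Allₚ.map⁺ (Allₚ.++⁻ʳ w₁ al))

-- The corner m is the smallest letter. Put in front of the word it lengthens the first row by one
-- and likewise every ascending chain, while the number of rows and the descending chain stay the
-- same.
crossing-prepend : IsTableau ((m ∷ r) ∷ T) → IsTableau (r ∷ T) → Unique (reading ((m ∷ r) ∷ T)) → 0 < m →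
                   Crossing (r ∷ T) → Crossing ((m ∷ r) ∷ T)
crossing-prepend {m} {r} {T} isT@(tableau _ ((m<r ∷ _) ∷ _) _) isT′ uq 0<m (crossing {w₁} {w₂} {t} e t∈ (_ , asc) (b , desc)) =
  crossing {before = m ∷ w₁} {w₂} {t}
    (cons m e ∙ ~-reading-ins unique ∙ ~-reflexive (cong reading (ins-prependMin (All.map <⇒≤ m<) (ins-reading isT′))))
    (∈-resp-↭ (↭-sym shifted) (there t∈))
    (0 , subst (0 <_) (sym fm≡) 0<m ∷ chain-rebase above asc)
    (b , skip desc)
  where
  m< : All (m <_) (reading (r ∷ T))
  m< = Allₚ.++⁺ (reading-All (tableau-corner isT)) m<r
  shifted : reading T ++ m ∷ r ↭ m ∷ reading T ++ r
  shifted = Permₚ.shift m (reading T) r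
  unique : Unique (m ∷ reading (r ∷ T))
  unique = unique-resp-↭ shifted uq
  m<t : m < t
  m<t = All.lookup m< t∈
  fm≡ : punch t m ≡ m
  fm≡ = punch-low (<⇒≤ m<t)
  above : All (punch t m <_) (spread t w₁ w₂)
  above = spread-All w₁ w₂
    (All.map (punch-increasing t) (Permₚ.All-resp-↭ (↭-sym (~⇒↭ e)) m<))
    (subst (_< suc t) (sym fm≡) (m≤n⇒m≤1+n m<t))

columnShift-↭ : ColumnShift ((α ∷ r) ∷ T) T′ → Linked Below ((α ∷ r) ∷ T) → reading ((α ∷ r) ∷ T) ↭ α ∷ reading T′
columnShift-↭ {α} {r} {T} {T′} sh be = ↭-trans (reading-↭ ((α ∷ r) ∷ T))
  (↭-trans (↭-reflexive (cong concat (sym (columnShift-← sh be))))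
    (↭-trans (concat-←-↭ T′ α) (prep α (↭-sym (reading-↭ T′)))))

-- Dually, the corner α is put at the end of the word. There it undoes the column shift, adding one
-- row, and as the smallest letter it prolongs the descending chain.
crossing-append : IsTableau ((α ∷ r) ∷ (α′ ∷ s) ∷ T) → Unique (reading ((α ∷ r) ∷ (α′ ∷ s) ∷ T)) → All (α′ <_) r →
                  ColumnShift ((α′ ∷ s) ∷ T) T′ → Crossing ((α′ ∷ r) ∷ T′) → Crossing ((α ∷ r) ∷ (α′ ∷ s) ∷ T)
crossing-append {α} {r} {α′} {s} {T} {T′} isT@(tableau _ ((α<r ∷ _) ∷ _) be) uq α′<r sh (crossing {w₁} {w₂} {t} e t∈ (b , asc) (b′ , desc)) =
  crossing {before = w₁} {w₂ ++ [ α ]} {t}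
    (~-reflexive (sym (++-assoc w₁ w₂ [ α ])) ∙ ~-++ʳ e ∙ reading-←-~ sorted unique′ ∙ ~-reflexive (cong reading (columnShift-← sh′ be)))
    (∈-resp-↭ (↭-sym perm) (there t∈))
    (b , subst (Chain _<_ _ b) spread-eq (chain-++ʳ asc))
    -- The bound is raised because b′ itself need not exceed the appended letter.
    (b′ + suc (punch t α) , subst₂ (λ k → Chain _>_ k (b′ + suc (punch t α))) (cong suc (cong suc (sym (columnShift-length sh)))) spread-eq
           (chain-snoc (spread-All w₁ w₂
               (All.map (punch-increasing t) (Permₚ.All-resp-↭ (↭-sym (~⇒↭ e)) α<))
               (subst (_< suc t) (sym (punch-low (<⇒≤ α<t))) (m≤n⇒m≤1+n α<t)))
             (m≤n+m (suc (punch t α)) b′) (chain->-raise (m≤m+n b′ (suc (punch t α))) desc)))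
  where
  sh′ : ColumnShift ((α ∷ r) ∷ (α′ ∷ s) ∷ T) ((α′ ∷ r) ∷ T′)
  sh′ = more α′<r sh
  perm : reading ((α ∷ r) ∷ (α′ ∷ s) ∷ T) ↭ α ∷ reading ((α′ ∷ r) ∷ T′)
  perm = columnShift-↭ sh′ be
  unique : Unique (α ∷ reading ((α′ ∷ r) ∷ T′))
  unique = unique-resp-↭ perm uq
  unique′ : Unique (reading ((α′ ∷ r) ∷ T′) ++ [ α ])
  unique′ = unique-resp-↭ (Permₚ.++-comm [ α ] (reading ((α′ ∷ r) ∷ T′))) unique
  sorted : All Sorted ((α′ ∷ r) ∷ T′)
  sorted = All.map (AllPairs.map <⇒≤) (IsTableau.strict (columnShift-tableau sh′ isT))
  α≤ : All (α ≤_) (reading ((α ∷ r) ∷ (α′ ∷ s) ∷ T))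
  α≤ = Allₚ.++⁺ (All.map <⇒≤ (reading-All (tableau-corner isT))) (≤-refl ∷ All.map <⇒≤ α<r)
  α< : All (α <_) (reading ((α′ ∷ r) ∷ T′))
  α< = All.zipWith (λ (p , q) → ≤∧≢⇒< p q) (All.tail (Permₚ.All-resp-↭ perm α≤) , AllPairs.head unique)
  α<t : α < t
  α<t = All.lookup α< t∈
  spread-eq : spread t w₁ w₂ ++ [ punch t α ] ≡ spread t w₁ (w₂ ++ [ α ])
  spread-eq = trans (++-assoc (map (punch t) w₁) _ _)
    (cong (λ u → map (punch t) w₁ ++ suc t ∷ u) (sym (map-++ (punch t) w₂ [ α ])))

spread-split : ∀ t u v w {w₂} → spread t (u ++ v ∷ w ∷ []) w₂ ≡ map (punch t) u ++ punch t v ∷ punch t w ∷ suc t ∷ map (punch t) w₂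
spread-split t u v w = trans (cong (_++ _) (map-++ (punch t) u (v ∷ w ∷ []))) (++-assoc (map (punch t) u) _ _)

module _ {a₁ a₂ as c₁ c₂ cs T} (isT : IsTableau ((a₁ ∷ a₂ ∷ as) ∷ (c₁ ∷ c₂ ∷ cs) ∷ T)) where

  private
    T₀ : Tableau
    T₀ = (a₁ ∷ a₂ ∷ as) ∷ (c₁ ∷ c₂ ∷ cs) ∷ T

    a₁<a₂ : a₁ < a₂
    a₁<a₂ = All.head (AllPairs.head (All.head (IsTableau.strict isT)))
    a₂<as : Strict (a₂ ∷ as)
    a₂<as = AllPairs.tail (All.head (IsTableau.strict isT))
    c-strict : Strict (c₁ ∷ c₂ ∷ cs)
    c-strict = All.head (All.tail (IsTableau.strict isT))
    c₁<c₂ : c₁ < c₂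
    c₁<c₂ = All.head (AllPairs.head c-strict)
    a₁<c₁ : a₁ < c₁
    a₁<c₁ with IsTableau.below isT
    ... | (p ∷ _) ∷ _ = p

  -- The new letter lies just above a₂, hence below c₁, and is inserted behind c₁ a₁ in the word.
  -- The ascending chain is a₁, the new letter, and the given chain; the descending one is the first
  -- column of T, c₁, the new letter, and a₂.
  crossing-row : 0 < a₁ → a₂ < c₁ → Chain _<_ (suc (length as)) c₁ (c₂ ∷ cs ++ a₂ ∷ as) → Crossing T₀
  crossing-row 0<a₁ a₂<c₁ chain =
    crossing {before = reading T ++ c₁ ∷ a₁ ∷ []} {c₂ ∷ cs ++ a₂ ∷ as} {a₂}
      (~-reflexive (++-assoc (reading T) (c₁ ∷ a₁ ∷ []) _) ∙ ~-++ˡ (reading T) (symm (slide-small c-strict a₁<c₁))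
        ∙ ~-reflexive (sym (++-assoc (reading T) (c₁ ∷ c₂ ∷ cs) _)))
      (∈-++⁺ʳ (reading ((c₁ ∷ c₂ ∷ cs) ∷ T)) (there (here refl)))
      (0 , subst (Chain _<_ _ 0) (sym (spread-split a₂ (reading T) c₁ a₁)) (chain-++ˡ (map f (reading T))
        (skip (subst (0 <_) (sym fa₁≡) 0<a₁ ∷ subst (_< suc a₂) (sym fa₁≡) (m≤n⇒m≤1+n a₁<a₂)
          ∷ chain-weaken <-trans v<fc₁ (chain-map f↗ chain)))))
      (subst₂ (Has _>_) (+-comm (length T) 3) (sym (spread-split a₂ (reading T) c₁ a₁))
        (firstColumn-descends T f↗ (tableau-tail (tableau-tail isT)) (All.map (All.map f↗) (tableau-corner (tableau-tail isT)))
          (≤-refl ∷ skip (v<fc₁ ∷ subst (Chain _>_ 1 (suc a₂)) (sym (map-++ f (c₂ ∷ cs) (a₂ ∷ as)))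
            (chain-++ˡ (map f (c₂ ∷ cs)) (s≤s (≤-reflexive (punch-low {a₂} ≤-refl)) ∷ []))))))
    where
    f : ℕ → ℕ
    f = punch a₂
    f↗ : StrictlyIncreasing f
    f↗ = punch-increasing a₂
    fa₁≡ : f a₁ ≡ a₁
    fa₁≡ = punch-low (<⇒≤ a₁<a₂)
    v<fc₁ : suc a₂ < f c₁
    v<fc₁ = subst (suc a₂ <_) (sym (punch-high a₂<c₁)) (s<s a₂<c₁)

  -- The new letter lies just above c₁ and is inserted behind c₁ c₂. The ascending chain is c₁, the
  -- new letter, a₂ and the rest of the row; the descending one comes through T to c₂ and goes on
  -- with the new letter and a₁.
  crossing-column : c₁ < a₂ → ShortcutDescent c₁ c₂ T → Crossing T₀
  crossing-column c₁<a₂ descent =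
    crossing {before = reading T ++ c₁ ∷ c₂ ∷ []} {cs ++ a₁ ∷ a₂ ∷ as} {c₁}
      (~-reflexive (trans (++-assoc (reading T) (c₁ ∷ c₂ ∷ []) _) (sym (++-assoc (reading T) (c₁ ∷ c₂ ∷ cs) _))))
      (∈-++⁺ˡ (∈-++⁺ʳ (reading T) (here refl)))
      (0 , subst (Chain _<_ _ 0) (sym (spread-split c₁ (reading T) c₁ c₂)) (chain-++ˡ (map f (reading T))
        (subst (0 <_) (sym fc₁≡) (≤-<-trans z≤n a₁<c₁) ∷ skip (s≤s (≤-reflexive fc₁≡) ∷
          subst (Chain _<_ _ _) (sym (map-++ f cs _)) (chain-++ˡ (map f cs)
            (skip (v<f c₁<a₂ ∷ chain-map f↗ (allPairs-chain a₂<as))))))))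
      (subst₂ (Has _>_) (cong suc (+-comm (length T) 2)) (sym (spread-split c₁ (reading T) c₁ c₂))
        (descent f↗ (v<f c₁<c₂ ∷ subst (Chain _>_ 1 (suc c₁)) (sym (map-++ f cs _)) (chain-++ˡ (map f cs)
          (subst (_< suc c₁) (sym (punch-low (<⇒≤ a₁<c₁))) (m≤n⇒m≤1+n a₁<c₁) ∷ [])))))
    where
    f : ℕ → ℕ
    f = punch c₁
    f↗ : StrictlyIncreasing f
    f↗ = punch-increasing c₁
    fc₁≡ : f c₁ ≡ c₁
    fc₁≡ = punch-low {c₁} ≤-refl
    v<f : ∀ {y} → c₁ < y → suc c₁ < f y
    v<f p = subst (suc c₁ <_) (sym (punch-high p)) (s<s p)

-- Induction on the size, removing the corner by sliding its row or its column when possible.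
cross : ∀ fuel {a₁ a₂ as c₁ c₂ cs T} → (let T₀ = (a₁ ∷ a₂ ∷ as) ∷ (c₁ ∷ c₂ ∷ cs) ∷ T) →
        length as + length T < fuel → IsTableau T₀ → Unique (reading T₀) → 0 < a₁ → Crossing T₀

cross-rowShift : ∀ fuel {a₁ a₂ as c₁ c₂ cs T} → (let T₀ = (a₁ ∷ a₂ ∷ as) ∷ (c₁ ∷ c₂ ∷ cs) ∷ T) →
                 length as + length T ≤ fuel → IsTableau T₀ → Unique (reading T₀) → 0 < a₁ →
                 a₂ < c₁ → Prefix _>_ (c₂ ∷ cs) as → Crossing T₀
cross-rowShift fuel {a₁} {a₂} {a₃ ∷ as} {c₁} {c₂} {cs} {T} size isT@(tableau (_ ∷ ne) ((_ ∷ a-strict) ∷ ss) (_ ∷ be)) uq 0<a₁ a₂<c₁ pre =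
  crossing-prepend isT isT′ uq 0<a₁
    (cross fuel size isT′ (AllPairs.tail (unique-resp-↭ (Permₚ.shift a₁ (reading ((c₁ ∷ c₂ ∷ cs) ∷ T)) (a₂ ∷ a₃ ∷ as)) uq))
      (≤-<-trans z≤n (All.head (AllPairs.head (All.head (IsTableau.strict isT))))))
  where
  isT′ : IsTableau _
  isT′ = tableau ((λ ()) ∷ ne) (a-strict ∷ ss) ((a₂<c₁ ∷ pre) ∷ be)

cross-columnShift : ∀ fuel {a₁ a₂ as c₁ c₂ cs T T′} → (let T₀ = (a₁ ∷ a₂ ∷ as) ∷ (c₁ ∷ c₂ ∷ cs) ∷ T) →
                    length as + length T ≤ fuel → IsTableau T₀ → Unique (reading T₀) →
                    c₁ < a₂ → ColumnShift ((c₁ ∷ c₂ ∷ cs) ∷ T) T′ → Crossing T₀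
cross-columnShift fuel {a₁} {a₂} {as} {c₁} {T = T} size isT@(tableau _ ((_ ∷ a-strict) ∷ _) be@((a₁<c₁ ∷ _) ∷ _)) uq c₁<a₂ sh@(more _ sh′) =
  crossing-append isT uq c₁<a sh
    (cross fuel
      (subst (_≤ fuel) (trans (cong (length as +_) (columnShift-length sh′)) (+-suc (length as) _)) size)
      (columnShift-tableau (more c₁<a sh) isT)
      (AllPairs.tail (unique-resp-↭ (columnShift-↭ (more c₁<a sh) be) uq))
      (≤-<-trans z≤n a₁<c₁))
  where
  c₁<a : All (c₁ <_) (a₂ ∷ as)
  c₁<a = c₁<a₂ ∷ All.map (<-trans c₁<a₂) (AllPairs.head a-strict)

cross (suc fuel) {a₁} {a₂} {as} {c₁} {c₂} {cs} {T} (s≤s size)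
  isT@(tableau _ ((_ ∷ a-strict) ∷ ss) ((_ ∷ below) ∷ _)) uq 0<a₁ with <-cmp a₂ c₁
... | tri≈ _ refl _ = ⊥-elim (unique-disjoint (reading ((c₁ ∷ c₂ ∷ cs) ∷ T)) uq (∈-++⁺ʳ (reading T) (here refl)) (there (here refl)))
... | tri< a₂<c₁ _ _ with rowScan (c₂ ∷ cs) (a₂ ∷ as) (All.head ss) a-strict below distinct
  where
  distinct : All (λ c → All (c ≢_) (a₂ ∷ as)) (c₂ ∷ cs)
  distinct = All.tabulate λ c∈ → All.tabulate λ a∈ → λ { refl →
    unique-disjoint (reading ((c₁ ∷ c₂ ∷ cs) ∷ T)) uq (∈-++⁺ʳ (reading T) (there c∈)) (there a∈) }
...   | inj₁ pre   = cross-rowShift fuel size isT uq 0<a₁ a₂<c₁ pre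
...   | inj₂ chain = crossing-row isT 0<a₁ a₂<c₁ chain
cross (suc fuel) {c₁ = c₁} {c₂} {cs} {T} (s≤s size) isT uq 0<a₁ | tri> _ _ c₁<a₂
  with columnScan T (tableau-tail isT) (allPairs-++ˡ (reading ((c₁ ∷ c₂ ∷ cs) ∷ T)) uq)
... | inj₁ descent  = crossing-column isT c₁<a₂ descent
... | inj₂ (_ , sh) = cross-columnShift fuel size isT uq c₁<a₂ sh

-- Deleting a letter from the larger tableau

⊆-++⁻ : ∀ xs → u ⊆ xs ++ w → ∃₂ λ u₁ u₂ → u ≡ u₁ ++ u₂ × u₁ ⊆ xs × u₂ ⊆ w
⊆-++⁻ []       s = [] , _ , refl , [] , s
⊆-++⁻ (x ∷ xs) (refl ∷ s) = let _ , _ , eq , p , q = ⊆-++⁻ xs s in _ , _ , cong (x ∷_) eq , refl ∷ p , q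
⊆-++⁻ (x ∷ xs) (_ ∷ʳ s)   = let _ , _ , eq , p , q = ⊆-++⁻ xs s in _ , _ , eq , x ∷ʳ p , q

⊆-full : u ⊆ w → length w ≤ length u → u ≡ w
⊆-full s p = Pointwise-≡⇒≡ (toPointwise (≤-antisym (length-mono-≤ s) p) s)

⊆-one-short : ∀ xs → u ⊆ xs ++ w → length (xs ++ w) ≤ suc (length u) →
              (∃ λ u₁ → u ≡ u₁ ++ w) ⊎ (∃ λ u₂ → u ≡ xs ++ u₂ × u₂ ⊆ w × length w ≤ suc (length u₂))
⊆-one-short {w = w} xs s p with ⊆-++⁻ xs s
... | u₁ , u₂ , refl , s₁ , s₂ rewrite length-++ xs {w} | length-++ u₁ {u₂} with length w ≤? length u₂
...   | yes q = inj₁ (u₁ , cong (u₁ ++_) (⊆-full s₂ q))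
...   | no ¬q = inj₂ (u₂ , cong (_++ u₂) (⊆-full s₁ len₁) , s₂ , len₂)
  where
  u₂<w : suc (length u₂) ≤ length w
  u₂<w = ≰⇒> ¬q
  len₁ : length xs ≤ length u₁
  len₁ = +-cancelʳ-≤ (suc (length u₂)) _ _ (≤-trans (+-monoʳ-≤ (length xs) u₂<w) (≤-trans p (≤-reflexive (sym (+-suc (length u₁) (length u₂))))))
  len₂ : length w ≤ suc (length u₂)
  len₂ = +-cancelˡ-≤ (length xs) _ _ (≤-trans p (≤-trans (≤-reflexive (sym (+-suc (length u₁) (length u₂)))) (+-monoˡ-≤ (suc (length u₂)) (length-mono-≤ s₁))))

-- Only the corner lies both in the first row and in the first column; after its removal,
-- the smaller one of its two neighbours restores the chain of the other kind.
delete-one : IsTableau T → Unique (reading T) → All (0 <_) (reading T) → 2 ≤ length T → 2 ≤ length (firstRow T) →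
             u ⊆ reading T → length (reading T) ≤ suc (length u) →
             Has _<_ (length (firstRow T)) u ⊎ Has _>_ (length T) u
delete-one {T = (x ∷ []) ∷ _} _ _ _ _ (s≤s ())
delete-one {T = _ ∷ []} _ _ _ (s≤s ())
delete-one {T = (_ ∷ _ ∷ _) ∷ [] ∷ _} (tableau (_ ∷ ne ∷ _) _ _) _ _ _ = ⊥-elim (ne refl)
delete-one {T = (x ∷ y ∷ r) ∷ (z ∷ r₂) ∷ T} isT@(tableau _ (st ∷ (z<r₂ ∷ _) ∷ _) _) uq pos _ _ u⊆ len
  with ⊆-one-short (reading ((z ∷ r₂) ∷ T)) u⊆ len
... | inj₁ (u₁ , refl) =
  inj₁ (0 , chain-++ˡ u₁ (All.head (Allₚ.++⁻ʳ (reading ((z ∷ r₂) ∷ T)) pos) ∷ allPairs-chain st))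
... | inj₂ (_ , refl , refl ∷ s , _) = inj₂ (subst₂ (Has _>_) (+-comm _ 1) (cong (_++ _) (map-id (reading ((z ∷ r₂) ∷ T))))
  (firstColumn-descends ((z ∷ r₂) ∷ T) id (tableau-tail isT) (tableau-corner isT) (≤-refl ∷ [])))
... | inj₂ (_ , refl , _ ∷ʳ s , len₂) with ⊆-full s (s≤s⁻¹ len₂) | <-cmp y z
...   | refl | tri≈ _ refl _ = ⊥-elim (unique-disjoint (reading ((z ∷ r₂) ∷ T)) uq (∈-++⁺ʳ (reading T) (here refl)) (there (here refl)))
...   | refl | tri< y<z _ _ = inj₂ (subst₂ (Has _>_) (+-comm _ 1) (cong (_++ y ∷ r) (map-id (reading ((z ∷ r₂) ∷ T))))
  (firstColumn-descends ((z ∷ r₂) ∷ T) id (tableau-tail isT)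
    ((y<z ∷ All.map (<-trans y<z) z<r₂) ∷ All.map (All.map (<-trans y<z)) (tableau-corner (tableau-tail isT)))
    (≤-refl ∷ [])))
...   | refl | tri> _ _ z<y = inj₁ (0 , subst (Chain _<_ _ 0) (sym (++-assoc (reading T) (z ∷ r₂) (y ∷ r)))
  (chain-++ˡ (reading T) (0<z ∷ chain-++ˡ r₂ (z<y ∷ allPairs-chain (AllPairs.tail st)))))
  where
  0<z : 0 < z
  0<z = All.lookup pos (∈-++⁺ˡ (∈-++⁺ʳ (reading T) (here refl)))

-- The bound of the given chain need not be a value of ρ, so a fresh bound is supplied for the
-- letter with which the chain begins.
has-unmap : ∀ {R : Rel ℕ 0ℓ} → (∀ {x y} → R (ρ x) (ρ y) → R x y) → All (λ x → ∃ λ b → R b x) w → Has R k (map ρ w) → Has R k w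
has-unmap {ρ} {R = R} f al (_ , c) = go refl al c
  where
  go : ∀ {k b w w′} → w′ ≡ map ρ w → All (λ x → ∃ λ b → R b x) w → Chain R k b w′ → Has R k w
  go _ _ []                                = 0 , []
  go {w = _ ∷ _} refl ((b , p) ∷ _) (_ ∷ c)  = b , p ∷ chain-unmap f c
  go {w = _ ∷ _} refl (_ ∷ al)      (skip c) = let _ , d = go refl al c in _ , skip d

nonHook-not-classClosed : ∀ {r c₁ c₂ cs T} → (let T₀ = r ∷ (c₁ ∷ c₂ ∷ cs) ∷ T) →
                          IsTableau T₀ → reading T₀ ↭ range n → ¬ ClassClosed (reading T₀)
nonHook-not-classClosed {r = []}     (tableau (ne ∷ _) _ _) _ _ = ⊥-elim (ne refl)
nonHook-not-classClosed {r = _ ∷ []} (tableau _ _ ((_ ∷ ()) ∷ _)) _ _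
nonHook-not-classClosed {n} {r = a₁ ∷ a₂ ∷ as} {c₁} {c₂} {cs} {T} isT perm closed = refute
  (cross (suc (length as + length T)) ≤-refl isT (unique-resp-↭ (↭-sym perm) (range-unique n))
    (All.head (Allₚ.++⁻ʳ (reading ((c₁ ∷ c₂ ∷ cs) ∷ T)) (range-positive perm))))
  where
  T₀ : Tableau
  T₀ = (a₁ ∷ a₂ ∷ as) ∷ (c₁ ∷ c₂ ∷ cs) ∷ T
  refute : Crossing T₀ → ⊥
  refute (crossing {w₁} {w₂} {t} e t∈ asc desc) = closed s-↭ s~ (contains (punch-increasing t) s⊆ (~-map (punch-increasing t) e)) avoids
    where
    s₀ : List ℕ
    s₀ = spread t w₁ w₂
    s⊆ : map (punch t) (w₁ ++ w₂) ⊆ s₀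
    s⊆ = subst (_⊆ s₀) (sym (map-++ (punch t) w₁ w₂)) (⊆-insert (map (punch t) w₁))
    t≤n : t ≤ n
    t≤n with ∈-applyUpTo⁻ suc (∈-resp-↭ perm t∈)
    ... | _ , i<n , refl = i<n
    s-↭ : s₀ ↭ range (suc n)
    s-↭ = ↭-trans (Permₚ.shift (suc t) (map (punch t) w₁) (map (punch t) w₂))
      (↭-trans (↭-reflexive (cong (suc t ∷_) (sym (map-++ (punch t) w₁ w₂))))
        (punch-↭ t≤n (↭-trans (~⇒↭ e) perm)))
    R₀ : Tableau
    R₀ = ins s₀
    s-unique : Unique s₀
    s-unique = unique-resp-↭ (↭-sym s-↭) (range-unique (suc n))
    isR : IsTableau R₀
    isR = ins-tableau s-unique
    s~ : s₀ ~ reading R₀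
    s~ = ~-reading-ins s-unique
    R-↭ : reading R₀ ↭ range (suc n)
    R-↭ = ↭-trans (↭-sym (~⇒↭ s~)) s-↭
    row-long : suc (length (firstRow T₀)) ≤ length (firstRow R₀)
    row-long = ascending-≤-firstRow s₀ asc
    column-long : suc (length T₀) ≤ length R₀
    column-long = descending-≤-rows R₀ (IsTableau.strict isR) (_ , proj₁ (chain->-~ s~) (proj₂ desc))
    avoids : ¬ ContainsClass (reading R₀) (reading T₀)
    avoids (contains {ρ₀} ρ₀↗ {u} u⊆ e′) with delete-one isR (unique-resp-↭ (~⇒↭ s~) s-unique) (range-positive R-↭)
      (≤-trans (s≤s (s≤s z≤n)) column-long) (≤-trans (s≤s (s≤s z≤n)) row-long) u⊆ len
      where
      -- The copy has n letters and R has n + 1, so just one letter of the reading word is missing.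
      len : length (reading R₀) ≤ suc (length u)
      len = ≤-reflexive (trans (trans (Permₚ.↭-length R-↭) (length-applyUpTo suc (suc n)))
        (cong suc (sym (trans (Permₚ.↭-length (~⇒↭ e′)) (trans (length-map ρ₀ (reading T₀)) (trans (Permₚ.↭-length perm) (length-applyUpTo suc n)))))))
    ... | inj₁ (_ , c) = <-irr (≤-trans row-long (subst (λ S → length (firstRow R₀) ≤ length (firstRow S)) (ins-reading isT)
      (ascending-≤-firstRow (reading T₀) (has-unmap (increasing⇒reflects-< ρ₀↗) (All.map (0 ,_) (range-positive perm)) (_ , proj₁ (chain-<-~ e′) c)))))
    ... | inj₂ (_ , c) = <-irr (≤-trans column-long
      (descending-≤-rows T₀ (IsTableau.strict isT) (has-unmap (increasing⇒reflects-< ρ₀↗) (All.universal (λ x → suc x , ≤-refl) _) (_ , proj₁ (chain->-~ e′) c))))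

-- Superstandard tableaux as words

applyUpTo-cong : ∀ {f g : ℕ → ℕ} → (∀ i → f i ≡ g i) → ∀ n → applyUpTo f n ≡ applyUpTo g n
applyUpTo-cong eq zero    = refl
applyUpTo-cong eq (suc n) = cong₂ _∷_ (eq 0) (applyUpTo-cong (eq ∘ suc) n)

applyUpTo-++ : ∀ (f : ℕ → ℕ) m n → applyUpTo f m ++ applyUpTo (λ i → f (m + i)) n ≡ applyUpTo f (m + n)
applyUpTo-++ f zero    n = refl
applyUpTo-++ f (suc m) n = cong (f 0 ∷_) (applyUpTo-++ (f ∘ suc) m n)

concat-fillFrom : ∀ k as → concat (fillFrom k as) ≡ applyUpTo (λ i → suc (k + i)) (sum as)
concat-fillFrom k []       = refl
concat-fillFrom k (a ∷ as) = trans (cong (applyUpTo _ a ++_)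
    (trans (concat-fillFrom (k + a) as) (applyUpTo-cong (λ i → cong suc (+-assoc k a i)) (sum as))))
  (applyUpTo-++ (λ i → suc (k + i)) a (sum as))

length-fillFrom : ∀ k as → map length (fillFrom k as) ≡ as
length-fillFrom k []       = refl
length-fillFrom k (a ∷ as) = cong₂ _∷_ (length-applyUpTo _ a) (length-fillFrom (k + a) as)

length-concat : ∀ (T : Tableau) → length (concat T) ≡ sum (map length T)
length-concat []      = refl
length-concat (r ∷ T) = trans (length-++ r) (cong (length r +_) (length-concat T))

concat-injective : ∀ (S T : Tableau) → map length S ≡ map length T → concat S ≡ concat T → S ≡ T
concat-injective []      []      _  _  = refl
concat-injective (s ∷ S) (r ∷ T) eq eq′ with ∷-injective eq
... | len , lens with ++-injective s r len eq′
...   | refl , eq″ = cong (s ∷_) (concat-injective S T lens eq″)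

-- A filling of a given shape is determined by its concatenation, so being superstandard becomes a
-- statement about one list: the concatenated rows, or the concatenated columns, run through 1, ...,
-- n.
fillFrom⇒range : ∀ T → T ≡ fillFrom 0 (map length T) → concat T ≡ range (length (concat T))
fillFrom⇒range T eq = trans (cong concat eq) (trans (concat-fillFrom 0 (map length T)) (cong range (sym (length-concat T))))

range⇒fillFrom : ∀ T → concat T ≡ range n → T ≡ fillFrom 0 (map length T)
range⇒fillFrom {n} T eq = concat-injective T _ (sym (length-fillFrom 0 _))
  (trans eq (trans (cong range (trans (sym (length-applyUpTo suc n)) (trans (cong length (sym eq)) (length-concat T))))
    (sym (concat-fillFrom 0 (map length T)))))

hookRows : ℕ → List ℕ → List ℕ → Tableau
hookRows x A C = (x ∷ A) ∷ map [_] C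

columns-singles : ∀ c C → columns (map [_] (c ∷ C)) ≡ [ c ∷ C ]
columns-singles c []       = refl
columns-singles c (c′ ∷ C) rewrite columns-singles c′ C = refl

columns-hook : ∀ x A C → columns (hookRows x A C) ≡ hookRows x C A
columns-hook x A []      = refl
columns-hook x A (c ∷ C) rewrite columns-singles c C = cong ((x ∷ c ∷ C) ∷_) (align A)
  where
  align : ∀ A → alignWith _ A [] ≡ map [_] A
  align []      = refl
  align (_ ∷ _) = refl

reading-hook : ∀ x A C → reading (hookRows x A C) ≡ reverse C ++ x ∷ A
reading-hook x A C = cong (_++ x ∷ A) (singles C)
  where
  singles : ∀ C → reading (map [_] C) ≡ reverse C
  singles []      = refl
  singles (c ∷ C) = trans (cong (_++ [ c ]) (singles C)) (sym (unfold-reverse c C))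

concat-hook : ∀ x A C → concat (hookRows x A C) ≡ x ∷ A ++ C
concat-hook x A C = cong (λ u → x ∷ A ++ u) (concat-map-[ C ])

-- Reversal of the word transposes the hook, which carries statements about the column over to the
-- row.
reverse-hook : ∀ x A C → reverse (reverse C ++ x ∷ A) ≡ reverse A ++ x ∷ C
reverse-hook x A C = trans (reverse-mid (reverse C) x A) (cong (λ u → reverse A ++ x ∷ u) (reverse-involutive C))

classClosed-[] : ClassClosed []
classClosed-[] _ _ _ ¬t∋ = ¬t∋ (contains {relabel = id} id (Sublist.minimum _) rfl)

columnSuper-classClosed : ∀ x A C → x ∷ C ++ A ≡ range n → ClassClosed (reverse C ++ x ∷ A)
columnSuper-classClosed x A C eq = subst ClassClosed
  (trans (cong (_++ A) (unfold-reverse x C)) (++-assoc (reverse C) [ x ] A))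
  (columnHook-classClosed C A eq)

rowSuper-classClosed : ∀ x A C → x ∷ A ++ C ≡ range n → ClassClosed (reverse C ++ x ∷ A)
rowSuper-classClosed x A C eq = subst ClassClosed (reverse-hook x C A) (classClosed-reverse (columnSuper-classClosed x C A eq))

singleRows : ∀ (T : Tableau) b → map length T ≡ replicate b 1 → ∃ λ C → T ≡ map [_] C
singleRows []                zero    _  = [] , refl
singleRows ((c ∷ []) ∷ T)    (suc b) eq = let C , eq′ = singleRows T b (proj₂ (∷-injective eq)) in c ∷ C , cong ([ c ] ∷_) eq′

superstandardHook-classClosed : ∀ T → All (_≢ []) T →
  T ≡ fillFrom 0 (map length T) ⊎ columns T ≡ fillFrom 0 (map length (columns T)) →
  IsHook (map length T) → ClassClosed (reading T)
superstandardHook-classClosed []             _        _ _ = classClosed-[]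
superstandardHook-classClosed ([] ∷ T)       (ne ∷ _) _ _ = ⊥-elim (ne refl)
superstandardHook-classClosed ((x ∷ A) ∷ T) _ super (inj₂ (_ , b , eq)) with singleRows T b (proj₂ (∷-injective eq))
... | C , refl = subst ClassClosed (sym (reading-hook x A C)) (closed super)
  where
  closed : _ → ClassClosed (reverse C ++ x ∷ A)
  closed (inj₁ row) = rowSuper-classClosed x A C (trans (sym (concat-hook x A C)) (fillFrom⇒range _ row))
  closed (inj₂ col) = columnSuper-classClosed x A C
    (trans (sym (trans (cong concat (columns-hook x A C)) (concat-hook x C A))) (fillFrom⇒range _ col))

-- From closedness to superstandard hooks

strict-range : Strict w → w ↭ range n → w ≡ range n
strict-range {n = n} st p = Pointwise-≡⇒≡ (↗↭↗⇒≋ ≤-totalOrder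
  (AllPairs⇒Linked (AllPairs.map <⇒≤ st)) (AllPairs⇒Linked (AllPairs.map <⇒≤ (range-strict n))) (↭⇒↭ₛ p))

strict-maximum : ∀ c C → Strict (c ∷ C) → ∃ λ y → y ∈ c ∷ C × All (_≤ y) (c ∷ C)
strict-maximum c []       _          = c , here refl , ≤-refl ∷ []
strict-maximum c (d ∷ C) (c<C ∷ st) =
  let y , y∈ , C≤y = strict-maximum d C st in y , there y∈ , <⇒≤ (All.lookup c<C y∈) ∷ C≤y

splitAt-≥ : ∀ y A → Strict A → ∃₂ λ A₁ A₂ → A ≡ A₁ ++ A₂ × All (_< y) A₁ × All (y ≤_) A₂
splitAt-≥ y []      _        = [] , [] , refl , [] , []
splitAt-≥ y (a ∷ A) (a<A ∷ st) with a <? y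
... | yes a<y = let A₁ , A₂ , eq , p , q = splitAt-≥ y A st in a ∷ A₁ , A₂ , cong (a ∷_) eq , a<y ∷ p , q
... | no  a≮y = [] , a ∷ A , refl , [] , ≮⇒≥ a≮y ∷ All.map (λ a<b → ≤-trans (≮⇒≥ a≮y) (<⇒≤ a<b)) a<A

-- The column ends at γ, so that γ + 1 lies in the row; were a letter of the row (except x)
-- below γ, the transposed hook would be obstructed.
column-first : ∀ {x A c C γ α} → (let hook = reverse (c ∷ C) ++ x ∷ A) →
  Strict (x ∷ A) → Strict (x ∷ c ∷ C) → hook ↭ range n → ClassClosed hook →
  γ ∈ c ∷ C → All (_≤ γ) (c ∷ C) → α ∈ A → γ < α → Strict (x ∷ (c ∷ C) ++ A)
column-first {n} {x} {A} {c} {C} {γ} {α} row column@(x<C ∷ _) perm closed γ∈ C≤γ α∈ γ<α with splitAt-≥ γ A (AllPairs.tail row)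
... | [] , _ , refl , _ , γ≤A = AllPairsₚ.++⁺ column (AllPairs.tail row)
  (All.map (λ y≤γ → All.map (≤-<-trans y≤γ) γ<A) (<⇒≤ (All.lookup x<C γ∈) ∷ C≤γ))
  where
  uq : Unique (reverse (c ∷ C) ++ x ∷ A)
  uq = unique-resp-↭ (↭-sym perm) (range-unique n)
  γ<A : All (γ <_) A
  γ<A = All.tabulate λ {y} y∈ → ≤∧≢⇒< (All.lookup γ≤A y∈) λ { refl →
    unique-disjoint (reverse (c ∷ C)) uq (∈-resp-↭ (↭-sym (Permₚ.↭-reverse (c ∷ C))) γ∈) (there y∈) }
... | A₁@(_ ∷ _) , [] , refl , A₁<γ , _ =
  ⊥-elim (<-asym γ<α (All.lookup (Allₚ.++⁺ A₁<γ []) α∈))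
... | A₁@(_ ∷ _) , h ∷ A₂ , refl , A₁<γ , γ≤h ∷ _ = ⊥-elim (obstructed γ h≡ A₁<γ C≤γ (All.lookup x<C γ∈))
  where
  hook-letters : reverse (c ∷ C) ++ x ∷ A ↭ (c ∷ C) ++ x ∷ A
  hook-letters = Permₚ.++⁺ʳ (x ∷ A) (Permₚ.↭-reverse (c ∷ C))
  uq : Unique ((c ∷ C) ++ x ∷ A)
  uq = unique-resp-↭ (↭-trans (↭-sym perm) hook-letters) (range-unique n)
  h∈A : h ∈ A
  h∈A = ∈-++⁺ʳ A₁ (here refl)
  γ<h : γ < h
  γ<h = ≤∧≢⇒< γ≤h λ { refl → unique-disjoint (c ∷ C) uq γ∈ (there h∈A) }
  h≤n : h ≤ n
  h≤n with ∈-applyUpTo⁻ suc (∈-resp-↭ perm (∈-++⁺ʳ (reverse (c ∷ C)) (there h∈A)))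
  ... | _ , i<n , refl = i<n
  -- Since γ < h ≤ n, the number γ + 1 is a letter. It exceeds the whole column, so it lies in the
  -- row, where h is the first letter above γ.
  next : suc γ ∈ (c ∷ C) ++ x ∷ A
  next = ∈-resp-↭ (↭-trans (↭-sym perm) hook-letters) (∈-applyUpTo⁺ suc (<-≤-trans γ<h h≤n))
  h≤next : h ≤ suc γ
  h≤next with ∈-++⁻ (c ∷ C) next
  ... | inj₁ p = ⊥-elim (<-irr (All.lookup C≤γ p))
  ... | inj₂ (here refl) = ⊥-elim (<-asym (All.lookup x<C γ∈) (n<1+n γ))
  ... | inj₂ (there p) with ∈-++⁻ A₁ p
  ...   | inj₁ q           = ⊥-elim (<-asym (All.lookup A₁<γ q) (n<1+n γ))
  ...   | inj₂ (here refl) = ≤-refl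
  ...   | inj₂ (there q)   = <⇒≤ (All.lookup (AllPairs.head (allPairs-++ʳ A₁ (AllPairs.tail row))) q)
  h≡ : h ≡ suc γ
  h≡ = ≤-antisym h≤next γ<h
  -- As γ > x, it has the form t + 1. In the reversed word the column is x, A₁, h, A₂, so γ becomes
  -- a row letter and h = t + 2 a column letter with A₁ between it and the corner.
  obstructed : ∀ γ → h ≡ suc γ → All (_< γ) A₁ → All (_≤ γ) (c ∷ C) → x < γ → ⊥
  obstructed (suc t) refl A₁<γ (c≤γ ∷ _) _ = hook-not-classClosed {C₁ = A₁} {C₂ = A₂} {A = C} (s≤s z≤n) (All.map s≤s⁻¹ A₁<γ) (s≤s c≤γ)
    row column
    (subst (_↭ range n) (reverse-hook x A (c ∷ C)) (↭-trans (Permₚ.↭-reverse _) perm))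
    (subst ClassClosed (reverse-hook x A (c ∷ C)) (classClosed-reverse closed))

-- When both legs are nonempty, their largest letters are compared: the leg with the smaller maximum
-- must be filled first. Reversal reduces one case to the other.
hook-superstandard : ∀ x A C → Strict (x ∷ A) → Strict (x ∷ C) → reverse C ++ x ∷ A ↭ range n →
                     ClassClosed (reverse C ++ x ∷ A) → Strict (x ∷ A ++ C) ⊎ Strict (x ∷ C ++ A)
hook-superstandard x A [] row _ _ _ = inj₁ (subst Strict (sym (++-identityʳ (x ∷ A))) row)
hook-superstandard x [] C _ column _ _ = inj₂ (subst Strict (sym (++-identityʳ (x ∷ C))) column)
hook-superstandard {n} x (a ∷ A) (c ∷ C) row column perm closed
  with strict-maximum a A (AllPairs.tail row) | strict-maximum c C (AllPairs.tail column)
... | α , α∈ , A≤α | γ , γ∈ , C≤γ with <-cmp γ α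
...   | tri< γ<α _ _ = inj₂ (column-first row column perm closed γ∈ C≤γ α∈ γ<α)
...   | tri> _ _ α<γ = inj₁ (column-first column row
  (subst (_↭ range n) (reverse-hook x (a ∷ A) (c ∷ C)) (↭-trans (Permₚ.↭-reverse _) perm))
  (subst ClassClosed (reverse-hook x (a ∷ A) (c ∷ C)) (classClosed-reverse closed)) α∈ A≤α γ∈ α<γ)
...   | tri≈ _ refl _ = ⊥-elim (unique-disjoint (reverse (c ∷ C)) (unique-resp-↭ (↭-sym perm) (range-unique n))
  (∈-resp-↭ (↭-sym (Permₚ.↭-reverse (c ∷ C))) γ∈) (there α∈))

tableau-singles : ∀ {c} T → IsTableau ([ c ] ∷ T) → ∃ λ C → [ c ] ∷ T ≡ map [_] (c ∷ C)
tableau-singles []                _                            = [] , refl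
tableau-singles ([] ∷ T)          (tableau (_ ∷ ne ∷ _) _ _)   = ⊥-elim (ne refl)
tableau-singles {c} ((d ∷ []) ∷ T) isT =
  let C , eq = tableau-singles T (tableau-tail isT) in d ∷ C , cong ([ c ] ∷_) eq
tableau-singles ((_ ∷ _ ∷ _) ∷ T) (tableau _ _ ((_ ∷ ()) ∷ _))

hook-column : ∀ {r} y C → Linked Below ((y ∷ r) ∷ map [_] C) → Linked _<_ (y ∷ C)
hook-column y []      _              = [-]
hook-column y (c ∷ C) ((p ∷ _) ∷ be) = p ∷ hook-column c C be

classClosed⇒superstandardHook : ∀ T → IsTableau T → reading T ↭ range n → ClassClosed (reading T) →
  (T ≡ fillFrom 0 (map length T) ⊎ columns T ≡ fillFrom 0 (map length (columns T))) × IsHook (map length T)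
classClosed⇒superstandardHook [] _ _ _ = inj₁ refl , inj₁ refl
classClosed⇒superstandardHook ([] ∷ _) (tableau (ne ∷ _) _ _) _ _ = ⊥-elim (ne refl)
classClosed⇒superstandardHook {n} ((x ∷ A) ∷ T) isT perm closed with rowsAreSingle T isT perm closed
  where
  rowsAreSingle : ∀ T → IsTableau ((x ∷ A) ∷ T) → reading ((x ∷ A) ∷ T) ↭ range n →
                  ClassClosed (reading ((x ∷ A) ∷ T)) → ∃ λ C → T ≡ map [_] C
  rowsAreSingle []                 _                          _    _      = [] , refl
  rowsAreSingle ([] ∷ _)           (tableau (_ ∷ ne ∷ _) _ _) _    _      = ⊥-elim (ne refl)
  rowsAreSingle ((c ∷ []) ∷ T)     isT                        _    _      =
    let C , eq = tableau-singles T (tableau-tail isT) in c ∷ C , eq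
  rowsAreSingle ((_ ∷ _ ∷ _) ∷ _) isT                        perm closed = ⊥-elim (nonHook-not-classClosed isT perm closed)
... | C , refl = super (hook-superstandard x A C (All.head (IsTableau.strict isT))
        (Linked⇒AllPairs <-trans (hook-column x C (IsTableau.below isT))) perm′
        (subst ClassClosed (reading-hook x A C) closed))
      , inj₂ (_ , length C , cong (_ ∷_) (lengths C))
  where
  perm′ : reverse C ++ x ∷ A ↭ range n
  perm′ = subst (_↭ range n) (reading-hook x A C) perm
  rows↭ : x ∷ A ++ C ↭ range n
  rows↭ = ↭-trans (↭-sym (↭-trans (Permₚ.++⁺ʳ (x ∷ A) (Permₚ.↭-reverse C)) (Permₚ.++-comm C (x ∷ A)))) perm′
  columns↭ : x ∷ C ++ A ↭ range n
  columns↭ = ↭-trans (prep x (Permₚ.++-comm C A)) rows↭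
  lengths : ∀ C → map length (map [_] C) ≡ replicate (length C) 1
  lengths []      = refl
  lengths (_ ∷ C) = cong (1 ∷_) (lengths C)
  super : Strict (x ∷ A ++ C) ⊎ Strict (x ∷ C ++ A) → _ ⊎ _
  super (inj₁ st) = inj₁ (range⇒fillFrom _ (trans (concat-hook x A C) (strict-range st rows↭)))
  super (inj₂ st) = inj₂ (range⇒fillFrom _
    (trans (cong concat (columns-hook x A C)) (trans (concat-hook x C A) (strict-range st columns↭))))

theorem5p8 : (P : SYT) → PatternKnuthClosed (K P) ⇔ (IsSuperstandard P × IsHook (shape P))
theorem5p8 P = mk⇔
  (λ closed → classClosed⇒superstandardHook (rows P) (isTableau P) (reading-range P) (closed⇒classClosed P closed))
  (λ (super , hook) → classClosed⇒closed P (superstandardHook-classClosed (rows P) (rowsNonempty P) super hook))
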